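{- Let $a,b\ge 1$ and let $\rho$ be the canonical sequential form of a non-crossing partition of length $a$; if $b\ge 2$, assume further that $\rho$ starts with a single $1$ (i.e. its initial run of $1$'s has length exactly one), with no such restriction if $b=1$. Let $\tau=(\rho+1)1^b$. Then the generating function counting the members of $NC_n$ for $n\ge 0$ according to the number of occurrences of the subword $\tau$ is $$\sum_{n\ge 0}\Big(\sum_{\pi\in NC_n}q^{\mu_\tau(\pi)}\Big)x^n=\frac{1+2(q-1)x^{a+b-1}-\sqrt{1-4x-4(q-1)x^{a+b}}}{2x(1+(q-1)x^{a+b-2})}.$$
   Context: A set partition of $[n]=\{1,\dots,n\}$ with blocks $B_1,\dots,B_k$ ordered so that $\min B_1<\cdots<\min B_k$ is represented by its canonical sequential form $\pi=\pi_1\cdots\pi_n$, where $i\in B_{\pi_i}$ for each $i$; $n$ is its length. It is non-crossing if $\pi$ contains no (not necessarily consecutive) subsequence of the form $a\,b\,a\,b$ with $a<b$. $NC_n$ denotes the set of non-crossing partitions of $[n]$, identified with their canonical sequential forms ($NC_0$ consists of the empty partition). A subword pattern is a finite sequence $\tau=\tau_1\cdots\tau_k$ of positive integers whose set of distinct letters is $[\ell]$ for some $\ell$. An occurrence of $\tau$ in a sequence $\sigma_1\cdots\sigma_n$ is an index $i\in[n-k+1]$ such that the string of consecutive letters $\sigma_i\cdots\sigma_{i+k-1}$ is order-isomorphic to $\tau$ (same relative order, including equalities). $\mu_\tau(\pi)$ denotes the number of occurrences of $\tau$ in $\pi$. $\rho+1$ is the sequence obtained by adding $1$ to each entry of $\rho$,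 $1^b$ is the word of $b$ ones, and juxtaposition is concatenation. The formula is an identity of formal power series in $x$ (over $\mathbb{Q}(q)$), the square root being the one with constant term $1$. -}

module Defs where

open import Level using (0ℓ; _⊔_)
open import Algebra.Bundles using (CommutativeRing)
open import Data.Empty using (⊥-elim)
open import Data.Fin.Base as Fin using (Fin; toℕ)
import Data.Fin.Properties as Fin
open import Data.List.Base
  using (List; []; _∷_; length; lookup; map; zip; take; drop; filter;
         takeWhile; upTo; foldr; cartesianProductWith)
open import Data.List.Extrema.Nat using (max; xs≤max; max≤v⁺)
open import Data.List.Membership.Propositional using (_∈_)
open import Data.List.Membership.Propositional.Properties using (∈-map⁺; ∈-upTo⁺)
open import Data.List.Membership.DecPropositional using () renaming (_∈?_ to member?)
open import Data.List.Relation.Binary.Sublist.Propositional using (_⊆_) renaming (lookup to ⊆-lookup)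
import Data.List.Relation.Binary.Sublist.DecPropositional as DecSublist
open import Data.List.Relation.Unary.All as All using (All; all?)
open import Data.List.Relation.Unary.Any using (here; there)
import Data.List.Relation.Unary.All.Properties as All
open import Data.Nat.Base as ℕ using (ℕ; zero; suc; _∸_; _≤_; _<_; z≤n; s≤s)
import Data.Nat.Properties as ℕ
open import Data.Product.Base using (_×_; _,_; ∃-syntax; proj₁; proj₂; uncurry)
open import Data.Rational.Base as ℚ using (ℚ; 0ℚ; 1ℚ)
import Data.Rational.Properties as ℚ
open import Function.Base using (_∘_)
open import Function.Bundles using (_⇔_; mk⇔; Equivalence)
open import Relation.Binary.PropositionalEquality as ≡ using (_≡_; _≢_)
open import Relation.Nullary.Decidable using (Dec; yes; no; _×-dec_; _→-dec_; ¬?; map′)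
open import Relation.Nullary.Negation using (¬_)

module PowerSeries {c ℓ} (R : CommutativeRing c ℓ) where

  open CommutativeRing R renaming (refl to ≈-refl; sym to ≈-sym; trans to ≈-trans)
  open import Algebra.Properties.Semiring.Sum semiring
    using (sum⁺-syntax; sum-cong-≋)
  open import Algebra.Properties.CommutativeSemigroup +-commutativeSemigroup
    using (interchange)
  open import Relation.Binary.Reasoning.Setoid setoid

  Series : Set c
  Series = ℕ → Carrier

  infix  4 _≈ˢ_
  infixl 6 _+ˢ_
  infixl 7 _*ˢ_
  infix  8 -ˢ_

  _≈ˢ_ : Series → Series → Set ℓ
  f ≈ˢ g = ∀ n → f n ≈ g n

  _+ˢ_ : Series → Series → Series
  (f +ˢ g) n = f n + g n

  -ˢ_ : Series → Series
  (-ˢ f) n = - f n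

  _*ˢ_ : Series → Series → Series
  (f *ˢ g) n = ∑[ i ≤ n ] (f (toℕ i) * g (n ∸ toℕ i))

  const : Carrier → Series
  const r zero    = r
  const r (suc _) = 0#

  X : Series
  X 1 = 1#
  X _ = 0#

  private
    tl : Series → Series
    tl f n = f (suc n)

  *ˢ-cong : ∀ {f f′ g g′} → f ≈ˢ f′ → g ≈ˢ g′ → (f *ˢ g) ≈ˢ (f′ *ˢ g′)
  *ˢ-cong f≈f′ g≈g′ n = sum-cong-≋ {suc n} λ i → *-cong (f≈f′ (toℕ i)) (g≈g′ (n ∸ toℕ i))

  -- The defining recursion (f * g) (suc n) = f 0 * g (suc n) + (tl f * g) n
  -- holds definitionally; this is its mirror image.
  *ˢ-suc : ∀ f g n → (f *ˢ g) (suc n) ≈ (f *ˢ (g ∘ suc)) n + f (suc n) * g 0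
  *ˢ-suc f g zero    = begin
    f 0 * g 1 + (f 1 * g 0 + 0#)   ≈⟨ +-assoc _ _ _ ⟨
    f 0 * g 1 + f 1 * g 0 + 0#     ≈⟨ +-identityʳ _ ⟩
    f 0 * g 1 + f 1 * g 0          ≈⟨ +-congʳ (+-identityʳ _) ⟨
    f 0 * g 1 + 0# + f 1 * g 0     ∎
  *ˢ-suc f g (suc n) = begin
    f 0 * g (2 ℕ.+ n) + (tl f *ˢ g) (suc n)                            ≈⟨ +-congˡ (*ˢ-suc (tl f) g n) ⟩
    f 0 * g (2 ℕ.+ n) + ((tl f *ˢ tl g) n + f (2 ℕ.+ n) * g 0)         ≈⟨ +-assoc _ _ _ ⟨
    f 0 * g (2 ℕ.+ n) + (tl f *ˢ tl g) n + f (2 ℕ.+ n) * g 0           ∎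

  *ˢ-comm : ∀ f g → (f *ˢ g) ≈ˢ (g *ˢ f)
  *ˢ-comm f g zero    = +-congʳ (*-comm _ _)
  *ˢ-comm f g (suc n) = begin
    f 0 * g (suc n) + (tl f *ˢ g) n   ≈⟨ +-cong (*-comm _ _) (*ˢ-comm (tl f) g n) ⟩
    g (suc n) * f 0 + (g *ˢ tl f) n   ≈⟨ +-comm _ _ ⟩
    (g *ˢ tl f) n + g (suc n) * f 0   ≈⟨ *ˢ-suc g f n ⟨
    (g *ˢ f) (suc n)                  ∎

  *ˢ-distribʳ : ∀ h f g → ((f +ˢ g) *ˢ h) ≈ˢ ((f *ˢ h) +ˢ (g *ˢ h))
  *ˢ-distribʳ h f g zero    = begin
    (f 0 + g 0) * h 0 + 0#                   ≈⟨ +-cong (distribʳ _ _ _) (≈-sym (+-identityʳ 0#)) ⟩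
    (f 0 * h 0 + g 0 * h 0) + (0# + 0#)      ≈⟨ interchange _ _ _ _ ⟩
    (f 0 * h 0 + 0#) + (g 0 * h 0 + 0#)      ∎
  *ˢ-distribʳ h f g (suc n) = begin
    (f 0 + g 0) * h (suc n) + ((tl f +ˢ tl g) *ˢ h) n
      ≈⟨ +-cong (distribʳ _ _ _) (*ˢ-distribʳ h (tl f) (tl g) n) ⟩
    (f 0 * h (suc n) + g 0 * h (suc n)) + ((tl f *ˢ h) n + (tl g *ˢ h) n)
      ≈⟨ interchange _ _ _ _ ⟩
    (f *ˢ h) (suc n) + (g *ˢ h) (suc n)  ∎

  *ˢ-scale : ∀ r f g n → ((λ k → r * f k) *ˢ g) n ≈ r * (f *ˢ g) n
  *ˢ-scale r f g zero    = begin
    r * f 0 * g 0 + 0#       ≈⟨ +-cong (*-assoc _ _ _) (≈-sym (zeroʳ r)) ⟩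
    r * (f 0 * g 0) + r * 0# ≈⟨ distribˡ _ _ _ ⟨
    r * (f 0 * g 0 + 0#)     ∎
  *ˢ-scale r f g (suc n) = begin
    r * f 0 * g (suc n) + ((λ k → r * tl f k) *ˢ g) n   ≈⟨ +-cong (*-assoc _ _ _) (*ˢ-scale r (tl f) g n) ⟩
    r * (f 0 * g (suc n)) + r * (tl f *ˢ g) n           ≈⟨ distribˡ _ _ _ ⟨
    r * (f *ˢ g) (suc n)                                ∎

  *ˢ-assoc : ∀ f g h → ((f *ˢ g) *ˢ h) ≈ˢ (f *ˢ (g *ˢ h))
  *ˢ-assoc f g h zero    = +-congʳ (begin
    (f 0 * g 0 + 0#) * h 0   ≈⟨ *-congʳ (+-identityʳ _) ⟩
    f 0 * g 0 * h 0          ≈⟨ *-assoc _ _ _ ⟩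
    f 0 * (g 0 * h 0)        ≈⟨ *-congˡ (+-identityʳ _) ⟨
    f 0 * (g 0 * h 0 + 0#)   ∎)
  *ˢ-assoc f g h (suc n) = begin
    (f 0 * g 0 + 0#) * h (suc n) + (((λ k → f 0 * tl g k) +ˢ (tl f *ˢ g)) *ˢ h) n
      ≈⟨ +-cong (*-congʳ (+-identityʳ _)) (*ˢ-distribʳ h (λ k → f 0 * tl g k) (tl f *ˢ g) n) ⟩
    f 0 * g 0 * h (suc n) + (((λ k → f 0 * tl g k) *ˢ h) n + ((tl f *ˢ g) *ˢ h) n)
      ≈⟨ +-cong (*-assoc _ _ _) (+-cong (*ˢ-scale (f 0) (tl g) h n) (*ˢ-assoc (tl f) g h n)) ⟩
    f 0 * (g 0 * h (suc n)) + (f 0 * (tl g *ˢ h) n + (tl f *ˢ (g *ˢ h)) n)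
      ≈⟨ +-assoc _ _ _ ⟨
    f 0 * (g 0 * h (suc n)) + f 0 * (tl g *ˢ h) n + (tl f *ˢ (g *ˢ h)) n
      ≈⟨ +-congʳ (distribˡ _ _ _) ⟨
    (f *ˢ (g *ˢ h)) (suc n)  ∎

  *ˢ-zeroˡ : ∀ f g → (∀ n → f n ≈ 0#) → ∀ n → (f *ˢ g) n ≈ 0#
  *ˢ-zeroˡ f g f≈0 zero    = ≈-trans (+-identityʳ _) (≈-trans (*-congʳ (f≈0 0)) (zeroˡ _))
  *ˢ-zeroˡ f g f≈0 (suc n) =
    ≈-trans (+-cong (≈-trans (*-congʳ (f≈0 0)) (zeroˡ _)) (*ˢ-zeroˡ (tl f) g (f≈0 ∘ suc) n)) (+-identityʳ 0#)

  *ˢ-identityˡ : ∀ f → (const 1# *ˢ f) ≈ˢ f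
  *ˢ-identityˡ f zero    = ≈-trans (+-identityʳ _) (*-identityˡ _)
  *ˢ-identityˡ f (suc n) =
    ≈-trans (+-cong (*-identityˡ _) (*ˢ-zeroˡ (tl (const 1#)) f (λ _ → ≈-refl) n)) (+-identityʳ _)

  seriesRing : CommutativeRing c ℓ
  seriesRing = record
    { Carrier = Series
    ; _≈_     = _≈ˢ_
    ; _+_     = _+ˢ_
    ; _*_     = _*ˢ_
    ; -_      = -ˢ_
    ; 0#      = λ _ → 0#
    ; 1#      = const 1#
    ; isCommutativeRing = record
      { isRing = record
        { +-isAbelianGroup = record
          { isGroup = record
            { isMonoid = record
              { isSemigroup = record
                { isMagma = record
                  { isEquivalence = record
                    { refl  = λ _ → ≈-refl
                    ; sym   = λ p n → ≈-sym (p n)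
                    ; trans = λ p q n → ≈-trans (p n) (q n)
                    }
                  ; ∙-cong = λ p q n → +-cong (p n) (q n)
                  }
                ; assoc = λ f g h n → +-assoc (f n) (g n) (h n)
                }
              ; identity = (λ f n → +-identityˡ (f n)) , (λ f n → +-identityʳ (f n))
              }
            ; inverse = (λ f n → -‿inverseˡ (f n)) , (λ f n → -‿inverseʳ (f n))
            ; ⁻¹-cong = λ p n → -‿cong (p n)
            }
          ; comm = λ f g n → +-comm (f n) (g n)
          }
        ; *-cong     = λ {f} {f′} {g} {g′} → *ˢ-cong {f} {f′} {g} {g′}
        ; *-assoc    = *ˢ-assoc
        ; *-identity = *ˢ-identityˡ , λ f n → ≈-trans (*ˢ-comm f (const 1#) n) (*ˢ-identityˡ f n)
        ; distrib    = (λ h f g n → ≈-trans (*ˢ-comm h (f +ˢ g) n)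
                          (≈-trans (*ˢ-distribʳ h f g n) (+-cong (*ˢ-comm f h n) (*ˢ-comm g h n))))
                     , *ˢ-distribʳ
        }
      ; *-comm = *ˢ-comm
      }
    }

  IsNonZero : Series → Set ℓ
  IsNonZero f = ∃[ n ] ¬ (f n ≈ 0#)

  -- S is the square root of A with constant term 1, which is unique when R
  -- is a domain of characteristic other than 2.
  record IsSqrt (S A : Series) : Set ℓ where
    field
      square       : S *ˢ S ≈ˢ A
      constantTerm : S 0 ≈ 1#

  -- F = N / D, which determines F when R is a domain.  D need not be a unit
  -- of the power series ring, as in (1 - √(1 - 4x)) / 2x, so the quotient is
  -- a relation rather than an operation.
  record IsQuotient (F N D : Series) : Set ℓ where
    field
      nonZero : IsNonZero D
      product : D *ˢ F ≈ˢ N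

module Fractions
  {c ℓ n} (D : CommutativeRing c ℓ)
  (NonZero : CommutativeRing.Carrier D → Set n)
  (1-nonZero : NonZero (CommutativeRing.1# D))
  (*-nonZero : ∀ {x y} → NonZero x → NonZero y → NonZero (CommutativeRing._*_ D x y))
  (*-cancelʳ : ∀ {x y z} → NonZero z →
    CommutativeRing._≈_ D (CommutativeRing._*_ D x z) (CommutativeRing._*_ D y z) →
    CommutativeRing._≈_ D x y)
  where

  open CommutativeRing D
  open import Algebra.Properties.Ring ring using (-‿distribˡ-*)
  open import Algebra.Solver.Ring.NaturalCoefficients.Default commutativeSemiring
    using (solve; _:+_; _:*_; _:=_; con)
  open import Relation.Binary.Reasoning.Setoid setoid

  record Fraction : Set (c ⊔ n) where
    constructor _/_⟨_⟩
    field
      num         : Carrier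
      den         : Carrier
      den-nonZero : NonZero den

  open Fraction public

  infix 4 _≈ᶠ_

  record _≈ᶠ_ (u v : Fraction) : Set ℓ where
    constructor crossMul
    field
      cross : num u * den v ≈ num v * den u

  open _≈ᶠ_ public

  fromDomain : Carrier → Fraction
  fromDomain x = x / 1# ⟨ 1-nonZero ⟩

  _+ᶠ_ _*ᶠ_ : Fraction → Fraction → Fraction
  u +ᶠ v = (num u * den v + num v * den u) / den u * den v
             ⟨ *-nonZero (den-nonZero u) (den-nonZero v) ⟩
  u *ᶠ v = (num u * num v) / den u * den v
             ⟨ *-nonZero (den-nonZero u) (den-nonZero v) ⟩

  -ᶠ_ : Fraction → Fraction
  -ᶠ u = (- num u) / den u ⟨ den-nonZero u ⟩

  private
    ≈ᶠ-trans : ∀ {u v w} → u ≈ᶠ v → v ≈ᶠ w → u ≈ᶠ w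
    ≈ᶠ-trans {u} {v} {w} (crossMul p) (crossMul q) = crossMul (*-cancelʳ (den-nonZero v) (begin
      num u * den w * den v     ≈⟨ swap (num u) (den w) (den v) ⟩
      num u * den v * den w     ≈⟨ *-congʳ p ⟩
      num v * den u * den w     ≈⟨ swap (num v) (den u) (den w) ⟩
      num v * den w * den u     ≈⟨ *-congʳ q ⟩
      num w * den v * den u     ≈⟨ swap (num w) (den v) (den u) ⟩
      num w * den u * den v     ∎))
      where
      swap : ∀ x y z → x * y * z ≈ x * z * y
      swap = solve 3 (λ x y z → x :* y :* z := x :* z :* y) refl

    +ᶠ-cong : ∀ {u u′ v v′} → u ≈ᶠ u′ → v ≈ᶠ v′ → (u +ᶠ v) ≈ᶠ (u′ +ᶠ v′)
    +ᶠ-cong {a / b ⟨ _ ⟩} {a′ / b′ ⟨ _ ⟩} {x / y ⟨ _ ⟩} {x′ / y′ ⟨ _ ⟩} (crossMul p) (crossMul q) = crossMul (begin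
      (a * y + x * b) * (b′ * y′)           ≈⟨ regroup a b b′ x y y′ ⟩
      (a * b′) * (y * y′) + (x * y′) * (b * b′)
        ≈⟨ +-cong (*-cong p (*-comm y y′)) (*-cong q (*-comm b b′)) ⟩
      (a′ * b) * (y′ * y) + (x′ * y) * (b′ * b)
        ≈⟨ regroup a′ b′ b x′ y′ y ⟨
      (a′ * y′ + x′ * b′) * (b * y)         ∎)
      where
      regroup : ∀ a b b′ x y y′ →
        (a * y + x * b) * (b′ * y′) ≈ (a * b′) * (y * y′) + (x * y′) * (b * b′)
      regroup = solve 6 (λ a b b′ x y y′ →
        (a :* y :+ x :* b) :* (b′ :* y′) := (a :* b′) :* (y :* y′) :+ (x :* y′) :* (b :* b′)) refl

    *ᶠ-cong : ∀ {u u′ v v′} → u ≈ᶠ u′ → v ≈ᶠ v′ → (u *ᶠ v) ≈ᶠ (u′ *ᶠ v′)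
    *ᶠ-cong {a / b ⟨ _ ⟩} {a′ / b′ ⟨ _ ⟩} {x / y ⟨ _ ⟩} {x′ / y′ ⟨ _ ⟩} (crossMul p) (crossMul q) = crossMul (begin
      a * x * (b′ * y′)        ≈⟨ regroup a x b′ y′ ⟩
      a * b′ * (x * y′)        ≈⟨ *-cong p q ⟩
      a′ * b * (x′ * y)        ≈⟨ regroup a′ x′ b y ⟨
      a′ * x′ * (b * y)        ∎)
      where
      regroup : ∀ a x b y → a * x * (b * y) ≈ a * b * (x * y)
      regroup = solve 4 (λ a x b y → a :* x :* (b :* y) := a :* b :* (x :* y)) refl

    -ᶠ-cong : ∀ {u v} → u ≈ᶠ v → (-ᶠ u) ≈ᶠ (-ᶠ v)
    -ᶠ-cong {u} {v} (crossMul p) = crossMul (begin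
      (- num u) * den v    ≈⟨ -‿distribˡ-* _ _ ⟨
      - (num u * den v)    ≈⟨ -‿cong p ⟩
      - (num v * den u)    ≈⟨ -‿distribˡ-* _ _ ⟩
      (- num v) * den u    ∎)

    -- Componentwise equal fractions are equal; every ring law except the
    -- inverse and distributive ones is of this kind.
    same : ∀ {u v} → num u ≈ num v → den u ≈ den v → u ≈ᶠ v
    same p q = crossMul (*-cong p (sym q))

    +ᶠ-assoc : ∀ u v w → ((u +ᶠ v) +ᶠ w) ≈ᶠ (u +ᶠ (v +ᶠ w))
    +ᶠ-assoc (a / b ⟨ _ ⟩) (x / y ⟨ _ ⟩) (s / t ⟨ _ ⟩) = same
      (solve 6 (λ a b x y s t →
        (a :* y :+ x :* b) :* t :+ s :* (b :* y) := a :* (y :* t) :+ (x :* t :+ s :* y) :* b) refl a b x y s t)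
      (*-assoc _ _ _)

    +ᶠ-comm : ∀ u v → (u +ᶠ v) ≈ᶠ (v +ᶠ u)
    +ᶠ-comm u v = same (+-comm _ _) (*-comm _ _)

    +ᶠ-identityˡ : ∀ u → (fromDomain 0# +ᶠ u) ≈ᶠ u
    +ᶠ-identityˡ (a / b ⟨ _ ⟩) = same
      (trans (+-cong (zeroˡ b) (*-identityʳ a)) (+-identityˡ a))
      (*-identityˡ b)

    -ᶠ-inverseˡ : ∀ u → ((-ᶠ u) +ᶠ u) ≈ᶠ fromDomain 0#
    -ᶠ-inverseˡ (a / b ⟨ _ ⟩) = crossMul (begin
      ((- a) * b + a * b) * 1#   ≈⟨ *-identityʳ _ ⟩
      (- a) * b + a * b          ≈⟨ distribʳ b (- a) a ⟨
      (- a + a) * b              ≈⟨ *-congʳ (-‿inverseˡ a) ⟩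
      0# * b                     ≈⟨ zeroˡ b ⟩
      0#                         ≈⟨ zeroˡ _ ⟨
      0# * (b * b)               ∎)

    *ᶠ-distribˡ : ∀ u v w → (u *ᶠ (v +ᶠ w)) ≈ᶠ ((u *ᶠ v) +ᶠ (u *ᶠ w))
    *ᶠ-distribˡ (a / b ⟨ _ ⟩) (x / y ⟨ _ ⟩) (s / t ⟨ _ ⟩) = crossMul
      (solve 6 (λ a b x y s t →
        (a :* (x :* t :+ s :* y)) :* ((b :* y) :* (b :* t)) :=
        ((a :* x) :* (b :* t) :+ (a :* s) :* (b :* y)) :* (b :* (y :* t))) refl a b x y s t)

    *ᶠ-comm : ∀ u v → (u *ᶠ v) ≈ᶠ (v *ᶠ u)
    *ᶠ-comm u v = same (*-comm _ _) (*-comm _ _)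

    *ᶠ-identityˡ : ∀ u → (fromDomain 1# *ᶠ u) ≈ᶠ u
    *ᶠ-identityˡ u = same (*-identityˡ _) (*-identityˡ _)

  infix 8 _⁻¹ᶠ⟨_⟩

  _⁻¹ᶠ⟨_⟩ : (u : Fraction) → NonZero (num u) → Fraction
  u ⁻¹ᶠ⟨ nz ⟩ = den u / num u ⟨ nz ⟩

  *ᶠ-inverseʳ : ∀ u (nz : NonZero (num u)) → (u *ᶠ (u ⁻¹ᶠ⟨ nz ⟩)) ≈ᶠ fromDomain 1#
  *ᶠ-inverseʳ u nz = crossMul (trans (*-identityʳ _) (trans (*-comm _ _) (sym (*-identityˡ _))))

  fractionRing : CommutativeRing (c ⊔ n) ℓ
  fractionRing = record
    { Carrier = Fraction
    ; _≈_     = _≈ᶠ_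
    ; _+_     = _+ᶠ_
    ; _*_     = _*ᶠ_
    ; -_      = -ᶠ_
    ; 0#      = fromDomain 0#
    ; 1#      = fromDomain 1#
    ; isCommutativeRing = record
      { isRing = record
        { +-isAbelianGroup = record
          { isGroup = record
            { isMonoid = record
              { isSemigroup = record
                { isMagma = record
                  { isEquivalence = record
                    { refl  = crossMul refl
                    ; sym   = λ p → crossMul (sym (cross p))
                    ; trans = ≈ᶠ-trans
                    }
                  ; ∙-cong = +ᶠ-cong
                  }
                ; assoc = +ᶠ-assoc
                }
              ; identity = +ᶠ-identityˡ , λ u → ≈ᶠ-trans (+ᶠ-comm u _) (+ᶠ-identityˡ u)
              }
            ; inverse = -ᶠ-inverseˡ , λ u → ≈ᶠ-trans (+ᶠ-comm u _) (-ᶠ-inverseˡ u)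
            ; ⁻¹-cong = -ᶠ-cong
            }
          ; comm = +ᶠ-comm
          }
        ; *-cong     = *ᶠ-cong
        ; *-assoc    = λ u v w → same (*-assoc _ _ _) (*-assoc _ _ _)
        ; *-identity = *ᶠ-identityˡ , λ u → ≈ᶠ-trans (*ᶠ-comm u _) (*ᶠ-identityˡ u)
        ; distrib    = *ᶠ-distribˡ
                     , λ u v w → ≈ᶠ-trans (*ᶠ-comm (v +ᶠ w) u)
                         (≈ᶠ-trans (*ᶠ-distribˡ u v w) (+ᶠ-cong (*ᶠ-comm u v) (*ᶠ-comm u w)))
        }
      ; *-comm = *ᶠ-comm
      }
    }

module Polynomials where

  open PowerSeries ℚ.+-*-commutativeRing
  private module S = CommutativeRing seriesRing

  record Polynomial : Set where
    constructor poly
    field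
      coeff  : Series
      bound  : ℕ
      vanish : ∀ {n} → bound ≤ n → coeff n ≡ 0ℚ

  open Polynomial public

  infix 4 _≈ᴾ_

  record _≈ᴾ_ (p q : Polynomial) : Set where
    constructor coeffwise
    field
      coeffs : coeff p ≈ˢ coeff q

  open _≈ᴾ_ public

  *ˢ-vanish : ∀ f g a b → (∀ {n} → a ≤ n → f n ≡ 0ℚ) → (∀ {n} → b ≤ n → g n ≡ 0ℚ) →
              ∀ {n} → a ℕ.+ b ≤ n → (f *ˢ g) n ≡ 0ℚ
  *ˢ-vanish f g zero    b fv gv {n} _ = *ˢ-zeroˡ f g (λ _ → fv z≤n) n
  *ˢ-vanish f g (suc a) b fv gv {suc n} (s≤s le) = ≡.cong₂ ℚ._+_
    (≡.trans (≡.cong (f 0 ℚ.*_) (gv (ℕ.≤-trans (ℕ.m≤n+m b a) (ℕ.m≤n⇒m≤1+n le)))) (ℚ.*-zeroʳ (f 0)))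
    (*ˢ-vanish (f ∘ suc) g a b (fv ∘ s≤s) gv le)

  polynomialRing : CommutativeRing 0ℓ 0ℓ
  polynomialRing = record
    { Carrier = Polynomial
    ; _≈_     = _≈ᴾ_
    ; _+_     = λ p q → poly (coeff p +ˢ coeff q) (bound p ℕ.⊔ bound q) λ le →
                  ≡.cong₂ ℚ._+_ (vanish p (ℕ.m⊔n≤o⇒m≤o (bound p) (bound q) le))
                                (vanish q (ℕ.m⊔n≤o⇒n≤o (bound p) (bound q) le))
    ; _*_     = λ p q → poly (coeff p *ˢ coeff q) (bound p ℕ.+ bound q)
                  (*ˢ-vanish (coeff p) (coeff q) (bound p) (bound q) (vanish p) (vanish q))
    ; -_      = λ p → poly (-ˢ coeff p) (bound p) λ le → ≡.cong (ℚ.-_) (vanish p le)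
    ; 0#      = poly S.0# 0 λ _ → ≡.refl
    ; 1#      = poly S.1# 1 λ { (s≤s _) → ≡.refl }
    ; isCommutativeRing = record
      { isRing = record
        { +-isAbelianGroup = record
          { isGroup = record
            { isMonoid = record
              { isSemigroup = record
                { isMagma = record
                  { isEquivalence = record
                    { refl  = coeffwise λ _ → ≡.refl
                    ; sym   = λ p → coeffwise (S.sym (coeffs p))
                    ; trans = λ p q → coeffwise (S.trans (coeffs p) (coeffs q))
                    }
                  ; ∙-cong = λ p q → coeffwise (S.+-cong (coeffs p) (coeffs q))
                  }
                ; assoc = λ p q r → coeffwise (S.+-assoc (coeff p) (coeff q) (coeff r))
                }
              ; identity = (λ p → coeffwise (S.+-identityˡ (coeff p)))
                         , (λ p → coeffwise (S.+-identityʳ (coeff p)))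
              }
            ; inverse = (λ p → coeffwise (S.-‿inverseˡ (coeff p)))
                      , (λ p → coeffwise (S.-‿inverseʳ (coeff p)))
            ; ⁻¹-cong = λ p → coeffwise (S.-‿cong (coeffs p))
            }
          ; comm = λ p q → coeffwise (S.+-comm (coeff p) (coeff q))
          }
        ; *-cong     = λ {p} {p′} {q} {q′} e e′ →
                         coeffwise (*ˢ-cong {coeff p} {coeff p′} {coeff q} {coeff q′} (coeffs e) (coeffs e′))
        ; *-assoc    = λ p q r → coeffwise (S.*-assoc (coeff p) (coeff q) (coeff r))
        ; *-identity = (λ p → coeffwise (S.*-identityˡ (coeff p)))
                     , (λ p → coeffwise (S.*-identityʳ (coeff p)))
        ; distrib    = (λ p q r → coeffwise (S.distribˡ (coeff p) (coeff q) (coeff r)))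
                     , (λ p q r → coeffwise (S.distribʳ (coeff p) (coeff q) (coeff r)))
        }
      ; *-comm = λ p q → coeffwise (S.*-comm (coeff p) (coeff q))
      }
    }

  indeterminate : Polynomial
  indeterminate = poly X 2 λ { (s≤s (s≤s _)) → ≡.refl }

  NonZero : Polynomial → Set
  NonZero p = IsNonZero (coeff p)

  private
    ℚ-domain : ∀ {x y} → x ≢ 0ℚ → y ≢ 0ℚ → x ℚ.* y ≢ 0ℚ
    ℚ-domain {x} {y} x≢0 y≢0 xy≡0 = y≢0 (begin
      y                            ≡⟨ ℚ.*-identityˡ y ⟨
      1ℚ ℚ.* y                     ≡⟨ ≡.cong (ℚ._* y) (ℚ.*-inverseˡ x) ⟨
      (ℚ.1/ x) ℚ.* x ℚ.* y         ≡⟨ ℚ.*-assoc (ℚ.1/ x) x y ⟩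
      (ℚ.1/ x) ℚ.* (x ℚ.* y)       ≡⟨ ≡.cong ((ℚ.1/ x) ℚ.*_) xy≡0 ⟩
      (ℚ.1/ x) ℚ.* 0ℚ              ≡⟨ ℚ.*-zeroʳ (ℚ.1/ x) ⟩
      0ℚ                           ∎)
      where
      open ≡.≡-Reasoning
      instance _ = ℚ.≢-nonZero x≢0

    series-domain : ∀ f g m n → f m ≢ 0ℚ → g n ≢ 0ℚ → IsNonZero (f *ˢ g)
    series-domain f g m n fm≢0 gn≢0 with f 0 ℚ.≟ 0ℚ | g 0 ℚ.≟ 0ℚ
    series-domain f g m n fm≢0 gn≢0 | no f0≢0 | no g0≢0 =
      0 , λ e → ℚ-domain f0≢0 g0≢0 (≡.trans (≡.sym (ℚ.+-identityʳ _)) e)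
    series-domain f g zero    n fm≢0 gn≢0 | yes f0≡0 | _ = ⊥-elim (fm≢0 f0≡0)
    series-domain f g (suc m) n fm≢0 gn≢0 | yes f0≡0 | _
      with k , nz ← series-domain (f ∘ suc) g m n fm≢0 gn≢0 =
      suc k , λ e → nz (begin
        ((f ∘ suc) *ˢ g) k                            ≡⟨ ℚ.+-identityˡ _ ⟨
        0ℚ ℚ.+ ((f ∘ suc) *ˢ g) k                     ≡⟨ ≡.cong (ℚ._+ ((f ∘ suc) *ˢ g) k) (ℚ.*-zeroˡ (g (suc k))) ⟨
        0ℚ ℚ.* g (suc k) ℚ.+ ((f ∘ suc) *ˢ g) k       ≡⟨ ≡.cong (λ z → z ℚ.* g (suc k) ℚ.+ ((f ∘ suc) *ˢ g) k) f0≡0 ⟨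
        (f *ˢ g) (suc k)                              ≡⟨ e ⟩
        0ℚ                                            ∎)
      where open ≡.≡-Reasoning
    series-domain f g m zero    fm≢0 gn≢0 | no _ | yes g0≡0 = ⊥-elim (gn≢0 g0≡0)
    series-domain f g m (suc n) fm≢0 gn≢0 | no _ | yes g0≡0
      with k , nz ← series-domain f (g ∘ suc) m n fm≢0 gn≢0 =
      suc k , λ e → nz (begin
        (f *ˢ (g ∘ suc)) k                            ≡⟨ ℚ.+-identityʳ _ ⟨
        (f *ˢ (g ∘ suc)) k ℚ.+ 0ℚ                     ≡⟨ ≡.cong ((f *ˢ (g ∘ suc)) k ℚ.+_) (ℚ.*-zeroʳ (f (suc k))) ⟨
        (f *ˢ (g ∘ suc)) k ℚ.+ f (suc k) ℚ.* 0ℚ       ≡⟨ ≡.cong (λ z → (f *ˢ (g ∘ suc)) k ℚ.+ f (suc k) ℚ.* z) g0≡0 ⟨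
        (f *ˢ (g ∘ suc)) k ℚ.+ f (suc k) ℚ.* g 0      ≡⟨ *ˢ-suc f g k ⟨
        (f *ˢ g) (suc k)                              ≡⟨ e ⟩
        0ℚ                                            ∎)
      where open ≡.≡-Reasoning

  open CommutativeRing polynomialRing using (_*_; _≈_; _-_; 1#; 0#; ring; trans; *-congʳ)
  open import Algebra.Properties.Ring ring using ([y-z]x≈yx-zx; x≈y⇒x∙y⁻¹≈ε; x∙y⁻¹≈ε⇒x≈y)

  1-nonZero : NonZero 1#
  1-nonZero = 0 , λ ()

  *-nonZero : ∀ {p q} → NonZero p → NonZero q → NonZero (p * q)
  *-nonZero {p} {q} (m , pm≢0) (n , qn≢0) = series-domain (coeff p) (coeff q) m n pm≢0 qn≢0

  *-cancelʳ : ∀ {p q r} → NonZero r → p * r ≈ q * r → p ≈ q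
  *-cancelʳ {p} {q} {r} r≢0 pr≈qr = x∙y⁻¹≈ε⇒x≈y p q (coeffwise p-q≈0)
    where
    [p-q]r≈0 : (p - q) * r ≈ 0#
    [p-q]r≈0 = trans ([y-z]x≈yx-zx r p q) (x≈y⇒x∙y⁻¹≈ε pr≈qr)

    p-q≈0 : ∀ n → coeff (p - q) n ≡ 0ℚ
    p-q≈0 n with coeff (p - q) n ℚ.≟ 0ℚ
    ... | yes e = e
    ... | no ne with k , nz ← *-nonZero {p - q} {r} (n , ne) r≢0 = ⊥-elim (nz (coeffs [p-q]r≈0 k))

open Fractions Polynomials.polynomialRing Polynomials.NonZero
  Polynomials.1-nonZero
  (λ {p} {q} → Polynomials.*-nonZero {p} {q})
  (λ {p} {q} {r} → Polynomials.*-cancelʳ {p} {q} {r})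
  using (fractionRing; fromDomain)

ℚ⟨q⟩ : CommutativeRing 0ℓ 0ℓ
ℚ⟨q⟩ = fractionRing

q : CommutativeRing.Carrier ℚ⟨q⟩
q = fromDomain Polynomials.indeterminate

open PowerSeries ℚ⟨q⟩ public
  using (Series; const; IsSqrt; IsQuotient) renaming (seriesRing to ℚ⟨q⟩[[x]]; X to x)

Word : Set
Word = List ℕ

IsBlockMin : (π : Word) → Fin (length π) → Set
IsBlockMin π i = ∀ j → lookup π j ≡ lookup π i → i Fin.≤ j

-- Block B_c consists of the positions of the letter c.
record IsCanonical (π : Word) : Set where
  field
    blockCount : ℕ
    letters    : ∀ c → c ∈ π ⇔ (1 ≤ c × c ≤ blockCount)
    ordered    : ∀ i j → IsBlockMin π i → IsBlockMin π j →
                 lookup π i < lookup π j → i Fin.< j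

NonCrossing : Word → Set
NonCrossing π = ∀ a b → a < b → ¬ ((a ∷ b ∷ a ∷ b ∷ []) ⊆ π)

isCanonical? : ∀ π → Dec (IsCanonical π)
isCanonical? π = map′ to from
  ( all? (1 ℕ.≤?_) π
  ×-dec all? (λ c → member? ℕ._≟_ c π) (map suc (upTo k))
  ×-dec Fin.all? λ i → Fin.all? λ j →
    isBlockMin? i →-dec (isBlockMin? j →-dec ((lookup π i ℕ.<? lookup π j) →-dec (i Fin.<? j))) )
  where
  k = max 0 π

  isBlockMin? : ∀ i → Dec (IsBlockMin π i)
  isBlockMin? i = Fin.all? λ j → (lookup π j ℕ.≟ lookup π i) →-dec (i Fin.≤? j)

  Decided : Set
  Decided = All (1 ≤_) π × All (_∈ π) (map suc (upTo k))
          × (∀ i j → IsBlockMin π i → IsBlockMin π j → lookup π i < lookup π j → i Fin.< j)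

  to : Decided → IsCanonical π
  to (pos , occ , ord) = record
    { blockCount = k
    ; letters    = λ c → mk⇔
        (λ c∈π → All.lookup pos c∈π , All.lookup (xs≤max 0 π) c∈π)
        λ { (s≤s {n = c′} _ , c≤k) → All.lookup occ (∈-map⁺ suc (∈-upTo⁺ c≤k)) }
    ; ordered    = ord
    }

  from : IsCanonical π → Decided
  from can =
      All.tabulate (λ c∈π → proj₁ (Equivalence.to (letters _) c∈π))
    , All.map⁺ (All.applyUpTo⁺₁ (λ c → c) k λ c<k → Equivalence.from (letters _)
        (s≤s z≤n , ℕ.≤-trans c<k (max≤v⁺ z≤n (All.tabulate λ c∈π → proj₂ (Equivalence.to (letters _) c∈π)))))
    , ordered
    where open IsCanonical can

nonCrossing? : ∀ π → Dec (NonCrossing π)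
nonCrossing? π = map′
  (λ h a b a<b s → All.lookup (All.lookup h (⊆-lookup s (here ≡.refl))) (⊆-lookup s (there (here ≡.refl))) a<b s)
  (λ h → All.tabulate λ {a} _ → All.tabulate λ {b} _ → h a b)
  (all? (λ a → all? (λ b → (a ℕ.<? b) →-dec ¬? ((a ∷ b ∷ a ∷ b ∷ []) ⊆? π)) π) π)
  where open DecSublist ℕ._≟_ using (_⊆?_)

wordsOver : Word → ℕ → List Word
wordsOver letters zero    = [] ∷ []
wordsOver letters (suc n) = cartesianProductWith _∷_ letters (wordsOver letters n)

-- A partition of [n] has at most n blocks, so its letters lie in [n].
NC : ℕ → List Word
NC n = filter (λ π → isCanonical? π ×-dec nonCrossing? π) (wordsOver (map suc (upTo n)) n)

_⇔-dec_ : ∀ {A B : Set} → Dec A → Dec B → Dec (A ⇔ B)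
a? ⇔-dec b? = map′ (uncurry mk⇔) (λ e → Equivalence.to e , Equivalence.from e)
                   ((a? →-dec b?) ×-dec (b? →-dec a?))

SameOrder : ℕ × ℕ → ℕ × ℕ → Set
SameOrder (u , v) (u′ , v′) = (u < u′ ⇔ v < v′) × (u ≡ u′ ⇔ v ≡ v′)

OrderIsomorphic : Word → Word → Set
OrderIsomorphic us vs =
  length us ≡ length vs × All (λ p → All (SameOrder p) (zip us vs)) (zip us vs)

orderIsomorphic? : ∀ us vs → Dec (OrderIsomorphic us vs)
orderIsomorphic? us vs =
  (length us ℕ.≟ length vs) ×-dec all? (λ p → all? (sameOrder? p) (zip us vs)) (zip us vs)
  where
  sameOrder? : ∀ p r → Dec (SameOrder p r)
  sameOrder? (u , v) (u′ , v′) =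
    ((u ℕ.<? u′) ⇔-dec (v ℕ.<? v′)) ×-dec ((u ℕ.≟ u′) ⇔-dec (v ℕ.≟ v′))

-- Occurrences are indexed from 0 here: i ranges over 0, …, n - k, and over
-- nothing when n < k.
μ : Word → Word → ℕ
μ τ σ = length (filter (λ i → orderIsomorphic? (take k (drop i σ)) τ) (upTo (suc (length σ) ∸ k)))
  where k = length τ

initialRun : Word → ℕ
initialRun π = length (takeWhile (ℕ._≟ 1) π)

genFun : Word → Series
genFun τ n = foldr _+_ 0# (map (λ π → q ^ μ τ π) (NC n))
  where
  open CommutativeRing ℚ⟨q⟩ using (_+_; 0#; semiring)
  open import Algebra.Properties.Semiring.Exp semiring using (_^_)

module Formula (a b : ℕ) where

  open CommutativeRing ℚ⟨q⟩[[x]] using (_+_; _*_; _-_; 1#; semiring)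
  open import Algebra.Properties.Semiring.Exp semiring using (_^_)
  open import Algebra.Properties.Semiring.Mult semiring renaming (_×_ to _·_) using ()

  [q-1] : Series
  [q-1] = const (q K.- K.1#)
    where module K = CommutativeRing ℚ⟨q⟩

  radicand : Series
  radicand = 1# - 4 · x - 4 · [q-1] * x ^ (a ℕ.+ b)

  numerator : Series → Series
  numerator √radicand = 1# + 2 · [q-1] * x ^ (a ℕ.+ b ∸ 1) - √radicand

  denominator : Series
  denominator = 2 · x * (1# + [q-1] * x ^ (a ℕ.+ b ∸ 2))

-- A nonempty non-crossing partition is uniquely 1 (α + 1) β, where α is a
-- non-crossing partition and β, once relabelled, is again one.  Every
-- occurrence of τ in it lies within α or within β, except for one more which
-- straddles the two exactly when α ends with a copy of ρ and β starts with 1ᵇ.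
-- Replacing the last letter of a nonempty partition by a copy of ρ is a
-- bijection onto the partitions ending with a copy of ρ: by non-crossing, all
-- letters of that copy but the smallest are new.  It preserves the number of
-- occurrences of τ; for b ≥ 2 this needs the single initial 1 of ρ.  Likewise
-- for prepending b - 1 ones to a nonempty partition.  Hence the generating
-- function F satisfies
--   F = 1 + x (F² + (q - 1) x^(a-1) (F - 1) x^(b-1) (F - 1)),
-- a quadratic equation whose solution is the stated formula.

module Submission where

open import Defs
open import Algebra.Bundles using (CommutativeRing)
open import Data.Empty using (⊥-elim)
open import Data.Fin.Base as Fin using (Fin; toℕ)
import Data.Fin.Properties as Fin
open import Data.List.Base
  using (List; []; _∷_; _++_; length; lookup; map; foldr; filter; take; drop; zip;
         concatMap; cartesianProductWith; replicate; upTo; applyUpTo)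
open import Data.List.Membership.Propositional using (_∈_; _∉_; find; lose)
open import Data.List.Membership.Propositional.Properties
  using (∈-map⁺; ∈-map⁻; ∈-++⁺ʳ; ∈-++⁻; ∈-filter⁺; ∈-filter⁻; ∈-concatMap⁺; ∈-concatMap⁻;
         ∈-cartesianProductWith⁺; ∈-cartesianProductWith⁻; ∈-upTo⁺; ∈-upTo⁻; ∈-lookup)
open import Data.List.Membership.Propositional.Properties.WithK using (unique∧set⇒bag)
open import Data.List.Properties
  using (∷-injective; ∷-injectiveʳ; map-injective; map-∘; length-map; length-++; length-replicate;
         take-map; take-all; ++-identityʳ)
open import Data.List.Relation.Binary.BagAndSetEquality using (∼bag⇒↭)
open import Data.List.Relation.Binary.Permutation.Propositional using (↭⇒↭ₛ′)
open import Data.List.Relation.Binary.Permutation.Propositional.Properties using () renaming (map⁺ to ↭-map⁺)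
import Data.List.Relation.Binary.Permutation.Setoid.Properties as ↭ₛ
open import Data.List.Relation.Binary.Sublist.Propositional
  using (_⊆_; []; _∷_; _∷ʳ_; ⊆-refl; ⊆-trans; from∈) renaming (lookup to ⊆-lookup)
import Data.List.Relation.Binary.Sublist.Propositional.Properties as Sublist
open import Data.List.Relation.Unary.All as All using (All; []; _∷_)
import Data.List.Relation.Unary.All.Properties as All
import Data.List.Relation.Unary.AllPairs as AllPairs
import Data.List.Relation.Unary.AllPairs.Properties as AllPairs
open import Data.List.Relation.Unary.Any using (here; there)
open import Data.List.Relation.Unary.Unique.Propositional using (Unique)
import Data.List.Relation.Unary.Unique.Propositional.Properties as Unique
open import Data.Nat.Base as ℕ using (ℕ; zero; suc; pred; _≤_; _<_; _∸_; z≤n; s≤s)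
import Data.Nat.Properties as ℕ
open import Data.Nat.Solver using (module +-*-Solver)
open import Data.Product.Base using (_×_; _,_; ∃-syntax; proj₁; proj₂)
open import Data.Sum.Base using (_⊎_; inj₁; inj₂; [_,_]′)
open import Function.Base using (_∘_; id)
open import Function.Bundles using (_⇔_; mk⇔; Equivalence)
open import Relation.Binary.Definitions using (tri<; tri≈; tri>)
open import Relation.Binary.PropositionalEquality as ≡ using (_≡_; _≢_; refl)
open import Relation.Nullary.Decidable using (Dec; yes; no; _×-dec_; _⊎-dec_; map′)
open import Relation.Nullary.Negation using (¬_)
open import Relation.Unary using (Decidable)

open Equivalence using (to; from)

-- Solving the quadratic equation

-- The decomposition `1 (α + 1) β` is recorded as a binary tree `node l r`, so that relabelling
-- disappears and the two bijections become grafts at the end of a path. Words are needed for only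
-- two facts: encodings of trees are exactly the non-crossing canonical words, and a window that
-- meets both `α + 1` and `β` can be an occurrence only if the boundary falls between `ρ + 1` and
-- `1^b`. The latter is a matter of order: all letters of `α + 1` exceed 1, while a nonempty `β`
-- starts with 1, the least letter of all. No square root is extracted. The equation
-- `denominator * F = numerator S` leaves a single candidate for `S`, and what has to be shown is
-- that its square is the radicand and its constant term 1; the quadratic equation for `F` gives the
-- former. The algebra is carried out over an arbitrary commutative ring with an arbitrary element
-- `q`. The field of rational functions enters only at the end, where 2 and `2q` must be nonzero for
-- the denominator to be a nonzero series.

module _ {c ℓ} (R : CommutativeRing c ℓ) where
  open CommutativeRing R renaming (refl to ≈-refl; sym to ≈-sym; trans to ≈-trans)
  open import Algebra.Properties.Semiring.Exp semiring using (_^_; ^-homo-*; ^-congʳ)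
  open import Algebra.Properties.Semiring.Mult semiring renaming (_×_ to _·_) using ()
  open import Algebra.Properties.Ring ring using (⁻¹-anti-homo‿-; xyx⁻¹≈y)
  open import Algebra.Properties.AbelianGroup +-abelianGroup using (⁻¹-∙-comm; ∙-cancelʳ)
  open import Algebra.Solver.Ring.NaturalCoefficients.Default commutativeSemiring
    using (solve; _:+_; _:*_; _:=_; con)
  open import Relation.Binary.Reasoning.Setoid setoid

  y≈x-[x-y] : ∀ x y → y ≈ x - (x - y)
  y≈x-[x-y] x y = ≈-sym (begin
    x - (x - y)        ≈⟨ +-congˡ (⁻¹-anti-homo‿- x y) ⟩
    x + (y - x)        ≈⟨ +-assoc _ _ _ ⟨
    x + y - x          ≈⟨ xyx⁻¹≈y x y ⟩
    y                  ∎)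

  -- This is (1 - T)² = 1 - 4x - 4ux²p with the terms moved so that no subtraction
  -- occurs; it is then a semiring identity up to one use of the equation for G.
  square-completion : ∀ x u p G → G ≈ x * ((1# + G) * (1# + G) + u * (p * (G * G))) →
    let T = 2 · x * (1# + (1# + u * p) * G) in
    4 · x + 4 · u * (x * (x * p)) + T * T ≈ T + T
  square-completion x u p G eq = begin
    4 · x + 4 · u * (x * (x * p)) + T * T
      ≈⟨ solve 4 (λ x u p G →
           let four z = z :+ (z :+ (z :+ (z :+ con 0)))
               t = (x :+ (x :+ con 0)) :* (con 1 :+ (con 1 :+ u :* p) :* G) in
           four x :+ four u :* (x :* (x :* p)) :+ t :* t
           := four x :* (con 1 :+ (con 1 :+ u :* p) :* (x :* ((con 1 :+ G) :* (con 1 :+ G) :+ u :* (p :* (G :* G)))))) ≈-refl x u p G ⟩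
    4 · x * (1# + (1# + u * p) * (x * ((1# + G) * (1# + G) + u * (p * (G * G)))))
      ≈⟨ *-congˡ (+-congˡ (*-congˡ eq)) ⟨
    4 · x * (1# + (1# + u * p) * G)
      ≈⟨ solve 4 (λ x u p G →
           let t = (x :+ (x :+ con 0)) :* (con 1 :+ (con 1 :+ u :* p) :* G) in
           (x :+ (x :+ (x :+ (x :+ con 0)))) :* (con 1 :+ (con 1 :+ u :* p) :* G) := t :+ t) ≈-refl x u p G ⟩
    T + T ∎
    where T = 2 · x * (1# + (1# + u * p) * G)

  -- The identity `S² + 2 (S + T) T = (S + T)² + T²` is free of subtraction and hence within reach
  -- of the semiring solver; `T²` is cancelled afterwards.
  square-of-complement : ∀ S T P Q → S + T ≈ 1# → P + Q + T * T ≈ T + T → S * S ≈ 1# - P - Q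
  square-of-complement S T P Q S+T≈1 eq = begin
    S * S                              ≈⟨ xyx⁻¹≈y (P + Q) (S * S) ⟨
    P + Q + S * S - (P + Q)            ≈⟨ +-cong SS+PQ≈1 (≈-sym (⁻¹-∙-comm P Q)) ⟩
    1# + (- P - Q)                     ≈⟨ +-assoc _ _ _ ⟨
    1# - P - Q                         ∎
    where
    SS+PQ≈1 : P + Q + S * S ≈ 1#
    SS+PQ≈1 = ∙-cancelʳ (T * T) _ _ (begin
      P + Q + S * S + T * T              ≈⟨ solve 4 (λ p q s t → p :+ q :+ s :* s :+ t :* t := s :* s :+ (p :+ q :+ t :* t)) ≈-refl P Q S T ⟩
      S * S + (P + Q + T * T)            ≈⟨ +-congˡ eq ⟩
      S * S + (T + T)                    ≈⟨ +-congˡ (+-cong (*-identityˡ T) (*-identityˡ T)) ⟨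
      S * S + (1# * T + 1# * T)          ≈⟨ +-congˡ (+-cong (*-congʳ S+T≈1) (*-congʳ S+T≈1)) ⟨
      S * S + ((S + T) * T + (S + T) * T)  ≈⟨ solve 2 (λ s t → s :* s :+ ((s :+ t) :* t :+ (s :+ t) :* t) := (s :+ t) :* (s :+ t) :+ t :* t) ≈-refl S T ⟩
      (S + T) * (S + T) + T * T          ≈⟨ +-congʳ (*-cong S+T≈1 S+T≈1) ⟩
      1# * 1# + T * T                    ≈⟨ +-congʳ (*-identityˡ 1#) ⟩
      1# + T * T                         ∎)

  -- Here `a` and `b` are one less than in the formula: they are the exponents by which the two
  -- graftings shift `G`. The complement `T = 1 - S` can be written without subtraction, because the
  -- term `2uxp` of `C` cancels against the one in `D * F` that comes from the constant term of `F`.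
  solve-quadratic : ∀ x u F G a b → F ≈ 1# + G →
    G ≈ x * (F * F + u * ((x ^ a * G) * (x ^ b * G))) →
    let m = suc a ℕ.+ suc b
        S = 1# + 2 · u * x ^ (m ∸ 1) - 2 · x * (1# + u * x ^ (m ∸ 2)) * F
    in S * S ≈ 1# - 4 · x - 4 · u * x ^ m
  solve-quadratic x u F G a b F≈1+G eq = begin
    S * S                                  ≈⟨ square-of-complement S T (4 · x) (4 · u * (x * (x * p))) S+T≈1 (square-completion x u p G eq′) ⟩
    1# - 4 · x - 4 · u * (x * (x * p))     ≈⟨ +-congˡ (-‿cong (*-congˡ xxp≈)) ⟩
    1# - 4 · x - 4 · u * x ^ m             ∎
    where
    m = suc a ℕ.+ suc b
    C = 1# + 2 · u * x ^ (m ∸ 1)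
    D = 2 · x * (1# + u * x ^ (m ∸ 2))
    S = C - D * F
    p = x ^ (m ∸ 2)
    T = 2 · x * (1# + (1# + u * p) * G)

    p≈ : x ^ a * x ^ b ≈ p
    p≈ = ≈-trans (≈-sym (^-homo-* x a b)) (^-congʳ x (≡.cong (_∸ 1) (≡.sym (ℕ.+-suc a b))))

    xp≈ : x * p ≈ x ^ (m ∸ 1)
    xp≈ = ^-congʳ x (≡.trans (≡.cong (λ n → suc (n ∸ 1)) (ℕ.+-suc a b)) (≡.sym (ℕ.+-suc a b)))

    xxp≈ : x * (x * p) ≈ x ^ m
    xxp≈ = *-congˡ xp≈

    eq′ : G ≈ x * ((1# + G) * (1# + G) + u * (p * (G * G)))
    eq′ = begin
      G                                                          ≈⟨ eq ⟩
      x * (F * F + u * ((x ^ a * G) * (x ^ b * G)))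
        ≈⟨ *-congˡ (+-cong (*-cong F≈1+G F≈1+G) (*-congˡ
             (≈-trans (solve 3 (λ y z G → (y :* G) :* (z :* G) := (y :* z) :* (G :* G)) ≈-refl (x ^ a) (x ^ b) G) (*-congʳ p≈)))) ⟩
      x * ((1# + G) * (1# + G) + u * (p * (G * G)))              ∎

    C+T≈DF+1 : C + T ≈ D * F + 1#
    C+T≈DF+1 = begin
      1# + 2 · u * x ^ (m ∸ 1) + T       ≈⟨ +-congʳ (+-congˡ (*-congˡ xp≈)) ⟨
      1# + 2 · u * (x * p) + T
        ≈⟨ solve 4 (λ x u p G →
             con 1 :+ (u :+ (u :+ con 0)) :* (x :* p) :+ (x :+ (x :+ con 0)) :* (con 1 :+ (con 1 :+ u :* p) :* G)
             := (x :+ (x :+ con 0)) :* (con 1 :+ u :* p) :* (con 1 :+ G) :+ con 1) ≈-refl x u p G ⟩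
      D * (1# + G) + 1#                  ≈⟨ +-congʳ (*-congˡ F≈1+G) ⟨
      D * F + 1#                         ∎

    S+T≈1 : S + T ≈ 1#
    S+T≈1 = begin
      C - D * F + T       ≈⟨ solve 3 (λ c d t → c :+ d :+ t := (c :+ t) :+ d) ≈-refl C (- (D * F)) T ⟩
      C + T - D * F       ≈⟨ +-congʳ C+T≈DF+1 ⟩
      D * F + 1# - D * F  ≈⟨ xyx⁻¹≈y (D * F) 1# ⟩
      1#                  ∎

-- Multiplication of series by powers of x.

module SeriesShift {c ℓ} (K : CommutativeRing c ℓ) where
  open CommutativeRing K renaming (refl to ≈-refl; sym to ≈-sym; trans to ≈-trans)
  open PowerSeries K using (seriesRing; X; *ˢ-zeroˡ; *ˢ-identityˡ) renaming (const to constᴷ; _*ˢ_ to infixl 7 _*ˢ_; _≈ˢ_ to infix 4 _≈ˢ_)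
  private module S = CommutativeRing seriesRing
  open import Algebra.Properties.Semiring.Exp S.semiring using (_^_)
  open import Relation.Binary.Reasoning.Setoid setoid

  const-*ˢ : ∀ r f n → (constᴷ r *ˢ f) n ≈ r * f n
  const-*ˢ r f zero    = +-identityʳ _
  const-*ˢ r f (suc n) = ≈-trans (+-congˡ (*ˢ-zeroˡ (constᴷ r ∘ suc) f (λ _ → ≈-refl) n)) (+-identityʳ _)

  X-*ˢ-zero : ∀ f → (X *ˢ f) 0 ≈ 0#
  X-*ˢ-zero f = ≈-trans (+-identityʳ _) (zeroˡ _)

  X-*ˢ-suc : ∀ f n → (X *ˢ f) (suc n) ≈ f n
  X-*ˢ-suc f n = begin
    0# * f (suc n) + ((X ∘ suc) *ˢ f) n   ≈⟨ +-cong (zeroˡ _) (S.*-cong {X ∘ suc} {S.1#} {f} {f} X∘suc≈1 S.refl n) ⟩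
    0# + (S.1# *ˢ f) n                    ≈⟨ +-identityˡ _ ⟩
    (S.1# *ˢ f) n                         ≈⟨ *ˢ-identityˡ f n ⟩
    f n                                   ∎
    where
    X∘suc≈1 : X ∘ suc ≈ˢ S.1#
    X∘suc≈1 zero    = ≈-refl
    X∘suc≈1 (suc _) = ≈-refl

  -- This turns a bijection that adds `k` to the size into the factor `x^k`, by comparing
  -- coefficients and never computing `X ^ k`.
  X^-*ˢ-unique : ∀ k f g → (∀ n → n < k → f n ≈ 0#) → (∀ n → f (k ℕ.+ n) ≈ g n) → f ≈ˢ X ^ k *ˢ g
  X^-*ˢ-unique zero    f g _    high n       = ≈-trans (high n) (≈-sym (*ˢ-identityˡ g n))
  X^-*ˢ-unique (suc k) f g low  high zero    =
    ≈-trans (low 0 (s≤s z≤n)) (≈-sym (≈-trans (S.*-assoc X (X ^ k) g 0) (X-*ˢ-zero (X ^ k *ˢ g))))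
  X^-*ˢ-unique (suc k) f g low  high (suc n) = begin
    f (suc n)                        ≈⟨ X^-*ˢ-unique k (f ∘ suc) g (λ n n<k → low (suc n) (s≤s n<k)) high n ⟩
    (X ^ k *ˢ g) n                   ≈⟨ X-*ˢ-suc (X ^ k *ˢ g) n ⟨
    (X *ˢ (X ^ k *ˢ g)) (suc n)      ≈⟨ S.*-assoc X (X ^ k) g (suc n) ⟨
    (X ^ suc k *ˢ g) (suc n)         ∎

-- Generating functions of trees

data Tree : Set where
  leaf : Tree
  node : Tree → Tree → Tree

data IsNode : Tree → Set where
  isNode : ∀ {l r} → IsNode (node l r)

size : Tree → ℕ
size leaf       = 0
size (node l r) = suc (size l ℕ.+ size r)

-- The trees of size n, provided that the fuel is at least n.
trees : (fuel n : ℕ) → List Tree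
trees _          zero    = leaf ∷ []
trees zero       (suc n) = []
trees (suc fuel) (suc n) =
  concatMap (λ i → cartesianProductWith node (trees fuel i) (trees fuel (n ∸ i))) (upTo (suc n))

∈-trees⁻ : ∀ fuel n {t} → t ∈ trees fuel n → size t ≡ n
∈-trees⁻ _          zero    (here refl) = refl
∈-trees⁻ (suc fuel) (suc n) t∈
  with i , i∈ , t∈′ ← find (∈-concatMap⁻ (λ i → cartesianProductWith node (trees fuel i) (trees fuel (n ∸ i))) {upTo (suc n)} t∈)
  with l , r , l∈ , r∈ , refl ← ∈-cartesianProductWith⁻ node (trees fuel i) (trees fuel (n ∸ i)) t∈′ =
  ≡.cong suc (≡.trans (≡.cong₂ ℕ._+_ (∈-trees⁻ fuel i l∈) (∈-trees⁻ fuel (n ∸ i) r∈))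
                      (ℕ.m+[n∸m]≡n (ℕ.≤-pred (∈-upTo⁻ i∈))))

∈-trees⁺ : ∀ {fuel} t → size t ≤ fuel → t ∈ trees fuel (size t)
∈-trees⁺ leaf _ = here refl
∈-trees⁺ {suc fuel} (node l r) (s≤s le) = ∈-concatMap⁺ _ (lose
  (∈-upTo⁺ (s≤s (ℕ.m≤m+n (size l) (size r))))
  (∈-cartesianProductWith⁺ node (∈-trees⁺ l (ℕ.m+n≤o⇒m≤o (size l) le))
    (≡.subst (λ n → r ∈ trees fuel n) (≡.sym (ℕ.m+n∸m≡n (size l) (size r)))
      (∈-trees⁺ r (ℕ.m+n≤o⇒n≤o (size l) le)))))

trees-unique : ∀ fuel n → Unique (trees fuel n)
trees-unique _          zero    = [] AllPairs.∷ AllPairs.[]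
trees-unique zero       (suc n) = AllPairs.[]
trees-unique (suc fuel) (suc n) = Unique.concat⁺
  (All.map⁺ (All.universal
    (λ i → Unique.cartesianProductWith⁺ node (λ { refl → refl , refl }) (trees-unique fuel i) (trees-unique fuel (n ∸ i)))
    (upTo (suc n))))
  (AllPairs.map⁺ (AllPairs.map disjoint (Unique.upTo⁺ (suc n))))
  where
  -- The index of the list that contains a tree is the size of its left subtree.
  disjoint : ∀ {i j} → ¬ (i ≡ j) → ∀ {t} →
    ¬ (t ∈ cartesianProductWith node (trees fuel i) (trees fuel (n ∸ i)) ×
       t ∈ cartesianProductWith node (trees fuel j) (trees fuel (n ∸ j)))
  disjoint {i} {j} i≢j (t∈i , t∈j)
    with l , r , l∈ , _ , refl ← ∈-cartesianProductWith⁻ node (trees fuel i) (trees fuel (n ∸ i)) t∈i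
    with _ , _ , l∈′ , _ , refl ← ∈-cartesianProductWith⁻ node (trees fuel j) (trees fuel (n ∸ j)) t∈j =
    i≢j (≡.trans (≡.sym (∈-trees⁻ fuel i l∈)) (∈-trees⁻ fuel j l∈′))

ind : ∀ {A : Set} → Dec A → ℕ
ind (yes _) = 1
ind (no _)  = 0

-- A bijection from the trees other than the leaf onto the trees satisfying P.
record Grafting (P : Tree → Set) (m : Tree → ℕ) (k : ℕ) : Set where
  field
    graft     : Tree → Tree
    injective : ∀ {s t} → graft s ≡ graft t → s ≡ t
    size-graft : ∀ {t} → IsNode t → size (graft t) ≡ k ℕ.+ size t
    preserves : ∀ {t} → IsNode t → m (graft t) ≡ m t
    onto      : ∀ {t} → P t → ∃[ s ] IsNode s × t ≡ graft s
    into      : ∀ {t} → IsNode t → P (graft t)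

-- Finite sums indexed by lists.

module ListSum {c ℓ} (K : CommutativeRing c ℓ) where
  open CommutativeRing K renaming (refl to ≈-refl; sym to ≈-sym; trans to ≈-trans)
  open import Algebra.Properties.CommutativeSemigroup +-commutativeSemigroup using (interchange)
  open import Relation.Binary.Reasoning.Setoid setoid

  private variable
    A B C : Set

  Σ : (A → Carrier) → List A → Carrier
  Σ f xs = foldr _+_ 0# (map f xs)

  Σ-cong : ∀ {f g : A → Carrier} xs → (∀ {x} → x ∈ xs → f x ≈ g x) → Σ f xs ≈ Σ g xs
  Σ-cong []       _   = ≈-refl
  Σ-cong (x ∷ xs) f≈g = +-cong (f≈g (here refl)) (Σ-cong xs (f≈g ∘ there))

  Σ-zero : ∀ {f : A → Carrier} xs → (∀ {x} → x ∈ xs → f x ≈ 0#) → Σ f xs ≈ 0#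
  Σ-zero []       _   = ≈-refl
  Σ-zero (x ∷ xs) f≈0 = ≈-trans (+-cong (f≈0 (here refl)) (Σ-zero xs (f≈0 ∘ there))) (+-identityˡ 0#)

  Σ-map : ∀ (f : B → Carrier) (g : A → B) xs → Σ f (map g xs) ≡ Σ (f ∘ g) xs
  Σ-map f g xs = ≡.cong (foldr _+_ 0#) (≡.sym (map-∘ xs))

  Σ-++ : ∀ (f : A → Carrier) xs ys → Σ f (xs ++ ys) ≈ Σ f xs + Σ f ys
  Σ-++ f []       ys = ≈-sym (+-identityˡ _)
  Σ-++ f (x ∷ xs) ys = ≈-trans (+-congˡ (Σ-++ f xs ys)) (≈-sym (+-assoc _ _ _))

  Σ-concatMap : ∀ (f : B → Carrier) (g : A → List B) xs → Σ f (concatMap g xs) ≈ Σ (λ x → Σ f (g x)) xs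
  Σ-concatMap f g []       = ≈-refl
  Σ-concatMap f g (x ∷ xs) = ≈-trans (Σ-++ f (g x) (concatMap g xs)) (+-congˡ (Σ-concatMap f g xs))

  Σ-cartesianProductWith : ∀ (f : C → Carrier) (g : A → B → C) xs ys →
    Σ f (cartesianProductWith g xs ys) ≈ Σ (λ x → Σ (f ∘ g x) ys) xs
  Σ-cartesianProductWith f g []       ys = ≈-refl
  Σ-cartesianProductWith f g (x ∷ xs) ys = ≈-trans (Σ-++ f (map (g x) ys) _)
    (+-cong (reflexive (Σ-map f (g x) ys)) (Σ-cartesianProductWith f g xs ys))

  Σ-+ : ∀ (f g : A → Carrier) xs → Σ (λ x → f x + g x) xs ≈ Σ f xs + Σ g xs
  Σ-+ f g []       = ≈-sym (+-identityˡ 0#)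
  Σ-+ f g (x ∷ xs) = ≈-trans (+-congˡ (Σ-+ f g xs)) (interchange _ _ _ _)

  Σ-*ˡ : ∀ r (f : A → Carrier) xs → Σ (λ x → r * f x) xs ≈ r * Σ f xs
  Σ-*ˡ r f []       = ≈-sym (zeroʳ r)
  Σ-*ˡ r f (x ∷ xs) = ≈-trans (+-congˡ (Σ-*ˡ r f xs)) (≈-sym (distribˡ _ _ _))

  Σ-*ʳ : ∀ r (f : A → Carrier) xs → Σ (λ x → f x * r) xs ≈ Σ f xs * r
  Σ-*ʳ r f []       = ≈-sym (zeroˡ r)
  Σ-*ʳ r f (x ∷ xs) = ≈-trans (+-congˡ (Σ-*ʳ r f xs)) (≈-sym (distribʳ _ _ _))

  Σ-product : ∀ (f : A → Carrier) (g : B → Carrier) xs ys →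
    Σ (λ x → Σ (λ y → f x * g y) ys) xs ≈ Σ f xs * Σ g ys
  Σ-product f g xs ys = ≈-trans (Σ-cong xs (λ {x} _ → Σ-*ˡ (f x) g ys)) (Σ-*ʳ (Σ g ys) f xs)

  -- Every change of index set, along a grafting or from words to trees, passes through this: two
  -- duplicate-free lists with the same members are permutations of each other.
  Σ-unique : ∀ (f : A → Carrier) {xs ys} → Unique xs → Unique ys →
    (∀ {z} → z ∈ xs → z ∈ ys) → (∀ {z} → z ∈ ys → z ∈ xs) → Σ f xs ≈ Σ f ys
  Σ-unique f uxs uys xs⊆ys ys⊆xs = ↭ₛ.foldr-commMonoid setoid +-isCommutativeMonoid
    (↭⇒↭ₛ′ isEquivalence (↭-map⁺ f (∼bag⇒↭ (unique∧set⇒bag uxs uys (mk⇔ xs⊆ys ys⊆xs)))))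

  iverson : Dec A → Carrier
  iverson (yes _) = 1#
  iverson (no _)  = 0#

  Σ-filter : ∀ {P : A → Set} (P? : Decidable P) (f : A → Carrier) xs →
    Σ (λ x → iverson (P? x) * f x) xs ≈ Σ f (filter P? xs)
  Σ-filter P? f []       = ≈-refl
  Σ-filter P? f (x ∷ xs) with P? x
  ... | yes _ = +-cong (*-identityˡ _) (Σ-filter P? f xs)
  ... | no  _ = ≈-trans (+-cong (zeroˡ _) (Σ-filter P? f xs)) (+-identityˡ _)

  open import Algebra.Properties.Semiring.Sum semiring using (sum)

  Σ-applyUpTo : ∀ (f : A → Carrier) (g : ℕ → A) n → Σ f (applyUpTo g n) ≈ sum {n} (λ i → f (g (Fin.toℕ i)))
  Σ-applyUpTo f g zero    = ≈-refl
  Σ-applyUpTo f g (suc n) = +-congˡ (Σ-applyUpTo f (g ∘ suc) n)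

module TreeSeries {c ℓ} (K : CommutativeRing c ℓ) (q : CommutativeRing.Carrier K)
  (m : Tree → ℕ) (P Q : Tree → Set) (P? : Decidable P) (Q? : Decidable Q)
  (m-leaf : m leaf ≡ 0)
  (m-node : ∀ l r → m (node l r) ≡ m l ℕ.+ m r ℕ.+ ind (P? l ×-dec Q? r))
  (j k : ℕ) (P-grafting : Grafting P m j) (Q-grafting : Grafting Q m k)
  where

  open CommutativeRing K renaming (refl to ≈-refl; sym to ≈-sym; trans to ≈-trans)
  open ListSum K
  open SeriesShift K
  open PowerSeries K using (seriesRing; X) renaming (Series to Seriesᴷ; const to constᴷ; _*ˢ_ to infixl 7 _*ˢ_; _≈ˢ_ to infix 4 _≈ˢ_; _+ˢ_ to infixl 6 _+ˢ_)
  private module S = CommutativeRing seriesRing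
  open import Algebra.Properties.Semiring.Exp semiring using (^-homo-*; ^-congʳ) renaming (_^_ to _^ᴷ_)
  open import Algebra.Properties.Semiring.Exp S.semiring using (_^_)
  open import Algebra.Properties.AbelianGroup +-abelianGroup using (xyx⁻¹≈y)
  open import Algebra.Properties.Semiring.Sum semiring using (sum; sum-cong-≋; ∑-distrib-+; *-distribˡ-sum)
  open import Algebra.Solver.Ring.NaturalCoefficients.Default commutativeSemiring
    using (solve; _:+_; _:*_; _:=_; con)
  open import Relation.Binary.Reasoning.Setoid setoid

  weight : Tree → Carrier
  weight t = q ^ᴷ m t

  F G : Seriesᴷ
  F n = Σ weight (trees n n)
  G zero    = 0#
  G (suc n) = F (suc n)

  Restricted : ∀ {P : Tree → Set} → Decidable P → Seriesᴷ
  Restricted P? n = Σ (λ t → iverson (P? t) * weight t) (trees n n)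

  restricted-grafting : ∀ {P : Tree → Set} (P? : Decidable P) {k} → Grafting P m k → Restricted P? ≈ˢ X ^ k *ˢ G
  restricted-grafting {P} P? {k} grafting = X^-*ˢ-unique k (Restricted P?) G (λ n n<k → low n (ℕ.<⇒≤ n<k)) high
    where
    open Grafting grafting
    -- The size `k` itself is included: a graft of a node is larger than `k`, in accordance with
    -- `G 0 = 0`.
    low : ∀ n → n ≤ k → Restricted P? n ≈ 0#
    low n n≤k = Σ-zero (trees n n) λ {t} t∈ → vanish t (≡.subst (_≤ k) (≡.sym (∈-trees⁻ n n t∈)) n≤k)
      where
      vanish : ∀ t → size t ≤ k → iverson (P? t) * weight t ≈ 0#
      vanish t size≤k with P? t
      ... | no  _  = zeroˡ _
      ... | yes pt with s , isNode , refl ← onto pt =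
        ⊥-elim (ℕ.<⇒≱ (ℕ.m<m+n k (s≤s z≤n)) (≡.subst (_≤ k) (size-graft {s} isNode) size≤k))

    node-of-size : ∀ {n} t → size t ≡ suc n → IsNode t
    node-of-size (node _ _) _ = isNode

    high : ∀ n → Restricted P? (k ℕ.+ n) ≈ G n
    high zero    = low (k ℕ.+ 0) (ℕ.≤-reflexive (ℕ.+-identityʳ k))
    high (suc n) = begin
      Σ (λ t → iverson (P? t) * weight t) (trees N N)     ≈⟨ Σ-filter P? weight (trees N N) ⟩
      Σ weight (filter P? (trees N N))
        ≈⟨ Σ-unique weight (Unique.filter⁺ P? (trees-unique N N)) (Unique.map⁺ injective (trees-unique (suc n) (suc n))) ∈-image⁺ ∈-image⁻ ⟩
      Σ weight (map graft (trees (suc n) (suc n)))        ≡⟨ Σ-map weight graft (trees (suc n) (suc n)) ⟩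
      Σ (weight ∘ graft) (trees (suc n) (suc n))
        ≈⟨ Σ-cong (trees (suc n) (suc n)) (λ {t} t∈ → ^-congʳ q (preserves (node-of-size t (∈-trees⁻ (suc n) (suc n) t∈)))) ⟩
      Σ weight (trees (suc n) (suc n))                    ∎
      where
      N = k ℕ.+ suc n

      ∈-image⁺ : ∀ {t} → t ∈ filter P? (trees N N) → t ∈ map graft (trees (suc n) (suc n))
      ∈-image⁺ t∈ with t∈′ , pt ← ∈-filter⁻ P? {xs = trees N N} t∈ with s , s-node , refl ← onto pt
        with size≡ ← ℕ.+-cancelˡ-≡ k (size s) (suc n) (≡.trans (≡.sym (size-graft s-node)) (∈-trees⁻ N N t∈′)) =
        ∈-map⁺ graft (≡.subst (λ n → s ∈ trees n n) size≡ (∈-trees⁺ s ℕ.≤-refl))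

      ∈-image⁻ : ∀ {t} → t ∈ map graft (trees (suc n) (suc n)) → t ∈ filter P? (trees N N)
      ∈-image⁻ t∈ with s , s∈ , refl ← ∈-map⁻ graft t∈
        with size≡ ← ∈-trees⁻ (suc n) (suc n) s∈
        with s-node ← node-of-size s size≡ =
        ∈-filter⁺ P? (≡.subst (λ n → graft s ∈ trees n n) (≡.trans (size-graft s-node) (≡.cong (k ℕ.+_) size≡))
          (∈-trees⁺ (graft s) ℕ.≤-refl)) (into s-node)

  -- The exponent is 0 or 1, so the power is affine in it. This is the origin of the factor `q - 1`
  -- in the formula, and it makes the weight of a node a sum of two products, each of which factors
  -- over the pair of subtrees.
  q^ind : ∀ {A B : Set} (A? : Dec A) (B? : Dec B) →
    q ^ᴷ ind (A? ×-dec B?) ≈ 1# + (q - 1#) * (iverson A? * iverson B?)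
  q^ind (yes _) (yes _) = begin
    q * 1#                           ≈⟨ *-identityʳ q ⟩
    q                                ≈⟨ xyx⁻¹≈y 1# q ⟨
    1# + q - 1#                      ≈⟨ +-assoc _ _ _ ⟩
    1# + (q - 1#)                    ≈⟨ +-congˡ (*-identityʳ _) ⟨
    1# + (q - 1#) * 1#               ≈⟨ +-congˡ (*-congˡ (*-identityʳ 1#)) ⟨
    1# + (q - 1#) * (1# * 1#)        ∎
  q^ind (yes _) (no _)  = ≈-sym (≈-trans (+-congˡ (≈-trans (*-congˡ (zeroʳ 1#)) (zeroʳ _))) (+-identityʳ 1#))
  q^ind (no _)  B?      = ≈-sym (≈-trans (+-congˡ (≈-trans (*-congˡ (zeroˡ _)) (zeroʳ _))) (+-identityʳ 1#))

  weight-node : ∀ l r → weight (node l r) ≈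
    weight l * weight r + (q - 1#) * ((iverson (P? l) * weight l) * (iverson (Q? r) * weight r))
  weight-node l r = begin
    q ^ᴷ m (node l r)                                 ≈⟨ ^-congʳ q (m-node l r) ⟩
    q ^ᴷ (m l ℕ.+ m r ℕ.+ ind (P? l ×-dec Q? r))      ≈⟨ ^-homo-* q (m l ℕ.+ m r) _ ⟩
    q ^ᴷ (m l ℕ.+ m r) * q ^ᴷ ind (P? l ×-dec Q? r)   ≈⟨ *-cong (^-homo-* q (m l) (m r)) (q^ind (P? l) (Q? r)) ⟩
    weight l * weight r * (1# + (q - 1#) * (iverson (P? l) * iverson (Q? r)))
      ≈⟨ solve 5 (λ v w u x y → v :* w :* (con 1 :+ u :* (x :* y)) := v :* w :+ u :* ((x :* v) :* (y :* w))) ≈-refl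
           (weight l) (weight r) (q - 1#) (iverson (P? l)) (iverson (Q? r)) ⟩
    weight l * weight r + (q - 1#) * ((iverson (P? l) * weight l) * (iverson (Q? r) * weight r)) ∎

  -- The subtrees of a tree of size `suc n` are both listed with fuel `n`, whereas the coefficients
  -- of a convolution use the fuels `i` and `n ∸ i`.
  fuel-irrelevant : ∀ (f : Tree → Carrier) {fuel n} → n ≤ fuel → Σ f (trees fuel n) ≈ Σ f (trees n n)
  fuel-irrelevant f {fuel} {n} n≤fuel = Σ-unique f (trees-unique fuel n) (trees-unique n n)
    (λ t∈ → transport (∈-trees⁻ fuel n t∈) ℕ.≤-refl) (λ t∈ → transport (∈-trees⁻ n n t∈) n≤fuel)
    where
    transport : ∀ {fuel t} → size t ≡ n → n ≤ fuel → t ∈ trees fuel n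
    transport {t = t} refl le = ∈-trees⁺ t le

  F-suc : ∀ n → F (suc n) ≈ (F *ˢ F) n + (q - 1#) * (Restricted P? *ˢ Restricted Q?) n
  F-suc n = begin
    F (suc n)
      ≈⟨ Σ-concatMap weight splits (upTo (suc n)) ⟩
    Σ (λ i → Σ weight (splits i)) (upTo (suc n))
      ≈⟨ Σ-applyUpTo (λ i → Σ weight (splits i)) id (suc n) ⟩
    sum {suc n} (λ i → Σ weight (splits (Fin.toℕ i)))
      ≈⟨ sum-cong-≋ {suc n} (λ i → splits-sum (Fin.toℕ i) (Fin.toℕ≤pred[n] i)) ⟩
    sum {suc n} (λ i → FF i + (q - 1#) * PQ i)
      ≈⟨ ∑-distrib-+ FF (λ i → (q - 1#) * PQ i) ⟩
    sum FF + sum (λ i → (q - 1#) * PQ i)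
      ≈⟨ +-congˡ (*-distribˡ-sum (q - 1#) PQ) ⟨
    (F *ˢ F) n + (q - 1#) * (Restricted P? *ˢ Restricted Q?) n ∎
    where
    splits : ℕ → List Tree
    splits i = cartesianProductWith node (trees n i) (trees n (n ∸ i))

    FF PQ : Fin.Fin (suc n) → Carrier
    FF i = F (Fin.toℕ i) * F (n ∸ Fin.toℕ i)
    PQ i = Restricted P? (Fin.toℕ i) * Restricted Q? (n ∸ Fin.toℕ i)

    splits-sum : ∀ i → i ≤ n → Σ weight (splits i) ≈ F i * F (n ∸ i) + (q - 1#) * (Restricted P? i * Restricted Q? (n ∸ i))
    splits-sum i i≤n = begin
      Σ weight (splits i)
        ≈⟨ Σ-cartesianProductWith weight node ls rs ⟩
      Σ (λ l → Σ (λ r → weight (node l r)) rs) ls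
        ≈⟨ Σ-cong ls (λ {l} _ → ≈-trans (Σ-cong rs (λ {r} _ → weight-node l r))
             (≈-trans (Σ-+ (λ r → weight l * weight r) (λ r → u * (wP l * wQ r)) rs)
               (+-congˡ (Σ-*ˡ u (λ r → wP l * wQ r) rs)))) ⟩
      Σ (λ l → Σ (λ r → weight l * weight r) rs + u * Σ (λ r → wP l * wQ r) rs) ls
        ≈⟨ ≈-trans (Σ-+ (λ l → Σ (λ r → weight l * weight r) rs) (λ l → u * Σ (λ r → wP l * wQ r) rs) ls)
             (+-congˡ (Σ-*ˡ u (λ l → Σ (λ r → wP l * wQ r) rs) ls)) ⟩
      Σ (λ l → Σ (λ r → weight l * weight r) rs) ls + u * Σ (λ l → Σ (λ r → wP l * wQ r) rs) ls
        ≈⟨ +-cong (Σ-product weight weight ls rs) (*-congˡ (Σ-product wP wQ ls rs)) ⟩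
      Σ weight ls * Σ weight rs + u * (Σ wP ls * Σ wQ rs)
        ≈⟨ +-cong (*-cong (fuel-irrelevant weight i≤n) (fuel-irrelevant weight (ℕ.m∸n≤m n i)))
             (*-congˡ (*-cong (fuel-irrelevant wP i≤n) (fuel-irrelevant wQ (ℕ.m∸n≤m n i)))) ⟩
      F i * F (n ∸ i) + u * (Restricted P? i * Restricted Q? (n ∸ i)) ∎
      where
      ls = trees n i
      rs = trees n (n ∸ i)
      u = q - 1#
      wP wQ : Tree → Carrier
      wP t = iverson (P? t) * weight t
      wQ t = iverson (Q? t) * weight t

  F≈1+G : F ≈ˢ S.1# S.+ G
  F≈1+G zero    = +-congʳ (^-congʳ q m-leaf)
  F≈1+G (suc n) = ≈-sym (+-identityˡ _)

  private
    H : Seriesᴷ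
    H = F *ˢ F +ˢ constᴷ (q - 1#) *ˢ ((X ^ j *ˢ G) *ˢ (X ^ k *ˢ G))

  G-equation : G ≈ˢ X *ˢ H
  G-equation zero    = ≈-sym (X-*ˢ-zero H)
  G-equation (suc n) = begin
    F (suc n)                                                                 ≈⟨ F-suc n ⟩
    (F *ˢ F) n + (q - 1#) * (Restricted P? *ˢ Restricted Q?) n
      ≈⟨ +-congˡ (*-congˡ (S.*-cong {Restricted P?} {X ^ j *ˢ G} {Restricted Q?} {X ^ k *ˢ G}
           (restricted-grafting P? P-grafting) (restricted-grafting Q? Q-grafting) n)) ⟩
    (F *ˢ F) n + (q - 1#) * ((X ^ j *ˢ G) *ˢ (X ^ k *ˢ G)) n                  ≈⟨ +-congˡ (const-*ˢ (q - 1#) ((X ^ j *ˢ G) *ˢ (X ^ k *ˢ G)) n) ⟨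
    H n                                                                       ≈⟨ X-*ˢ-suc H n ⟨
    (X *ˢ H) (suc n)                                                          ∎

-- Non-crossing partitions as trees

StrictlyMonotone : (ℕ → ℕ) → Set
StrictlyMonotone f = ∀ {c d} → c < d → f c < f d

mono-injective : ∀ {f} → StrictlyMonotone f → ∀ {c d} → f c ≡ f d → c ≡ d
mono-injective mono {c} {d} eq with ℕ.<-cmp c d
... | tri< c<d _ _ = ⊥-elim (ℕ.<⇒≢ (mono c<d) eq)
... | tri≈ _ c≡d _ = c≡d
... | tri> _ _ d<c = ⊥-elim (ℕ.<⇒≢ (mono d<c) (≡.sym eq))

-- Leaves room for k further blocks between block 1 and the others.
makeRoom : ℕ → ℕ → ℕ
makeRoom k 0             = 0
makeRoom k 1             = 1
makeRoom k (suc (suc c)) = suc (suc (k ℕ.+ c))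

makeRoom-mono : ∀ k → StrictlyMonotone (makeRoom k)
makeRoom-mono k {0}           {1}           _              = s≤s z≤n
makeRoom-mono k {0}           {suc (suc d)} _              = s≤s z≤n
makeRoom-mono k {1}           {1}           (s≤s ())
makeRoom-mono k {1}           {suc (suc d)} _              = s≤s (s≤s z≤n)
makeRoom-mono k {suc (suc c)} {suc (suc d)} (s≤s (s≤s lt)) = s≤s (s≤s (ℕ.+-monoʳ-< k lt))

makeRoom-injective : ∀ k {c d} → makeRoom k c ≡ makeRoom k d → c ≡ d
makeRoom-injective k = mono-injective (λ {c} {d} → makeRoom-mono k {c} {d})

-- Block 1 of the right part is the block of the initial 1 and must not be counted twice, hence
-- `pred`; an empty right part contributes 0 either way.
blocks : Tree → ℕ
blocks leaf       = 0
blocks (node l r) = suc (blocks l ℕ.+ pred (blocks r))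

-- The word is 1 (α + 1) β, where β starts at the second 1 and the blocks of β
-- other than block 1 are numbered after those of α.
encode : Tree → Word
encode leaf       = []
encode (node l r) = 1 ∷ map suc (encode l) ++ map (makeRoom (blocks l)) (encode r)

length-encode : ∀ t → length (encode t) ≡ size t
length-encode leaf       = refl
length-encode (node l r) = ≡.cong suc (≡.trans (length-++ (map suc (encode l)))
  (≡.cong₂ ℕ._+_ (≡.trans (length-map suc (encode l)) (length-encode l))
                 (≡.trans (length-map _ (encode r)) (length-encode r))))

-- Reading the word raises the number of blocks seen so far from the first index to the last.
data RestrictedGrowth : ℕ → Word → ℕ → Set where
  done : ∀ {k} → RestrictedGrowth k [] k
  old  : ∀ {k k′ c w} → 1 ≤ c → c ≤ k → RestrictedGrowth k w k′ → RestrictedGrowth k (c ∷ w) k′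
  new  : ∀ {k k′ w} → RestrictedGrowth (suc k) w k′ → RestrictedGrowth k (suc k ∷ w) k′

module _ where
  private
    RG = RestrictedGrowth

  RG-++ : ∀ {k k′ k″ u v} → RG k u k′ → RG k′ v k″ → RG k (u ++ v) k″
  RG-++ done         s = s
  RG-++ (old p q r)  s = old p q (RG-++ r s)
  RG-++ (new r)      s = new (RG-++ r s)

  RG-++⁻ : ∀ {k k″} u {v} → RG k (u ++ v) k″ → ∃[ k′ ] RG k u k′ × RG k′ v k″
  RG-++⁻ []      r           = _ , done , r
  RG-++⁻ (_ ∷ u) (old p q r) with _ , s , t ← RG-++⁻ u r = _ , old p q s , t
  RG-++⁻ (_ ∷ u) (new r)     with _ , s , t ← RG-++⁻ u r = _ , new s , t

  RG-functional : ∀ {k w k′ k″} → RG k w k′ → RG k w k″ → k′ ≡ k″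
  RG-functional done        done          = refl
  RG-functional (old _ _ r) (old _ _ s)   = RG-functional r s
  RG-functional (old _ p r) (new s)       = ⊥-elim (ℕ.1+n≰n p)
  RG-functional (new r)     (old _ p s)   = ⊥-elim (ℕ.1+n≰n p)
  RG-functional (new r)     (new s)       = RG-functional r s

  RG-increasing : ∀ {k w k′} → RG k w k′ → k ≤ k′
  RG-increasing done        = ℕ.≤-refl
  RG-increasing (old _ _ r) = RG-increasing r
  RG-increasing (new r)     = ℕ.≤-trans (ℕ.n≤1+n _) (RG-increasing r)

  RG-length : ∀ {k w k′} → RG k w k′ → k′ ≤ k ℕ.+ length w
  RG-length done        = ℕ.m≤m+n _ 0
  RG-length {k} (old _ _ r) = ℕ.≤-trans (RG-length r) (ℕ.+-monoʳ-≤ k (ℕ.n≤1+n _))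
  RG-length {k} (new r)     = ℕ.≤-trans (RG-length r) (ℕ.≤-reflexive (≡.sym (ℕ.+-suc k _)))

  RG-∈⁻ : ∀ {k w k′ c} → RG k w k′ → c ∈ w → 1 ≤ c × c ≤ k′
  RG-∈⁻ (old p q r) (here refl) = p , ℕ.≤-trans q (RG-increasing r)
  RG-∈⁻ (old _ _ r) (there c∈)  = RG-∈⁻ r c∈
  RG-∈⁻ (new r)     (here refl) = s≤s z≤n , RG-increasing r
  RG-∈⁻ (new r)     (there c∈)  = RG-∈⁻ r c∈

  RG-∈⁺ : ∀ {k w k′ c} → RG k w k′ → k < c → c ≤ k′ → c ∈ w
  RG-∈⁺ done        k<c c≤k = ⊥-elim (ℕ.<⇒≱ k<c c≤k)
  RG-∈⁺ (old _ _ r) k<c c≤k′ = there (RG-∈⁺ r k<c c≤k′)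
  RG-∈⁺ {k} {c = c} (new r) k<c c≤k′ with c ℕ.≟ suc k
  ... | yes c≡ = here c≡
  ... | no  c≢ = there (RG-∈⁺ r (ℕ.≤∧≢⇒< k<c (c≢ ∘ ≡.sym)) c≤k′)

  RG-suc : ∀ {k w k′} → RG k w k′ → RG (suc k) (map suc w) (suc k′)
  RG-suc done        = done
  RG-suc (old _ q r) = old (s≤s z≤n) (s≤s q) (RG-suc r)
  RG-suc (new r)     = new (RG-suc r)

  RG-suc⁻ : ∀ {k w k′} → RG (suc k) w k′ → All (1 ≢_) w →
            ∃[ v ] ∃[ j ] w ≡ map suc v × k′ ≡ suc j × RG k v j
  RG-suc⁻ done _ = [] , _ , refl , refl , done
  RG-suc⁻ (old {c = 1} _ _ _) (1≢1 ∷ _) = ⊥-elim (1≢1 refl)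
  RG-suc⁻ (old {c = suc (suc c)} _ (s≤s q) r) (_ ∷ 1∉)
    with v , j , refl , refl , s ← RG-suc⁻ r 1∉ = suc c ∷ v , j , refl , refl , old (s≤s z≤n) q s
  RG-suc⁻ (new r) (_ ∷ 1∉)
    with v , j , refl , refl , s ← RG-suc⁻ r 1∉ = _ ∷ v , j , refl , refl , new s

  -- Both counts are successors because block 1 must already be open: only then do the reserved `k`
  -- blocks lie below every new one, so that the counts are raised uniformly by `k`.
  RG-makeRoom : ∀ k {i w j} → RG (suc i) w (suc j) → RG (suc (k ℕ.+ i)) (map (makeRoom k) w) (suc (k ℕ.+ j))
  RG-makeRoom k done = done
  RG-makeRoom k (old {c = 1} _ _ r) = old (s≤s z≤n) (s≤s z≤n) (RG-makeRoom k r)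
  RG-makeRoom k (old {c = suc (suc c)} _ (s≤s q) r) =
    old (s≤s z≤n) (s≤s (ℕ.≤-trans (ℕ.≤-reflexive (≡.sym (ℕ.+-suc k c))) (ℕ.+-monoʳ-≤ k q))) (RG-makeRoom k r)
  RG-makeRoom k {i} {j = j} (new {w = w} r) =
    new (≡.subst (λ n → RG (suc n) (map (makeRoom k) w) (suc (k ℕ.+ j))) (ℕ.+-suc k i) (RG-makeRoom k r))

  RG-makeRoom⁻ : ∀ k {i w k′} → RG (suc (k ℕ.+ i)) w k′ → All (λ c → c ≡ 1 ⊎ suc k < c) w →
                 ∃[ v ] ∃[ j ] w ≡ map (makeRoom k) v × RG (suc i) v j
  RG-makeRoom⁻ k done _ = [] , _ , refl , done
  RG-makeRoom⁻ k (old _ _ r) (inj₁ refl ∷ ps)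
    with v , j , refl , s ← RG-makeRoom⁻ k r ps = 1 ∷ v , j , refl , old (s≤s z≤n) (s≤s z≤n) s
  RG-makeRoom⁻ k {i} (old {c = c} _ q r) (inj₂ k<c ∷ ps)
    with d , refl ← ℕ.m≤n⇒∃[o]m+o≡n k<c
    with v , j , refl , s ← RG-makeRoom⁻ k r ps =
    suc (suc d) ∷ v , j , refl ,
    old (s≤s z≤n) (s≤s (ℕ.+-cancelˡ-≤ k _ _ (≡.subst (_≤ k ℕ.+ i) (≡.sym (ℕ.+-suc k d)) (ℕ.≤-pred q)))) s
  RG-makeRoom⁻ k {i} {k′ = k′} (new {w = w} r) (_ ∷ ps)
    with v , j , refl , s ← RG-makeRoom⁻ k (≡.subst (λ n → RG (suc n) w k′) (≡.sym (ℕ.+-suc k i)) r) ps =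
    suc (suc i) ∷ v , j , refl , new s

  RG-encode : ∀ t → RG 0 (encode t) (blocks t)
  RG-encode leaf = done
  RG-encode (node l r) = new (RG-++ (RG-suc (RG-encode l)) (right r (RG-encode r)))
    where
    right : ∀ r → RG 0 (encode r) (blocks r) →
      RG (suc (blocks l)) (map (makeRoom (blocks l)) (encode r)) (suc (blocks l ℕ.+ pred (blocks r)))
    right leaf       _       = ≡.subst (λ n → RG (suc (blocks l)) [] (suc n)) (≡.sym (ℕ.+-identityʳ (blocks l))) done
    right (node _ _) (old _ () _)
    right r@(node _ _) (new {w = w} s) = old (s≤s z≤n) (s≤s z≤n)
      (≡.subst (λ n → RG (suc n) (map (makeRoom (blocks l)) w) (suc (blocks l ℕ.+ pred (blocks r)))) (ℕ.+-identityʳ (blocks l)) (RG-makeRoom (blocks l) s))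

  -- Restricted growth as a condition on a single position. The number `k` stands for the letters of
  -- a prefix that has already been read, which lets the condition pass from a word to its tail.
  Smaller : ℕ → (w : Word) → Fin (length w) → Set
  Smaller k w j = ∀ d → 1 ≤ d → d < lookup w j → d ≤ k ⊎ ∃[ i ] i Fin.< j × lookup w i ≡ d

  RG-smaller : ∀ {k w k′} → RG k w k′ → ∀ j → Smaller k w j
  RG-smaller (old _ q r) Fin.zero d _ d<c = inj₁ (ℕ.≤-trans (ℕ.<⇒≤ d<c) q)
  RG-smaller (new r)     Fin.zero d _ d<c = inj₁ (ℕ.≤-pred d<c)
  RG-smaller (old _ q r) (Fin.suc j) d 1≤d d<c with RG-smaller r j d 1≤d d<c
  ... | inj₁ d≤k             = inj₁ d≤k
  ... | inj₂ (i , i<j , refl) = inj₂ (Fin.suc i , s≤s i<j , refl)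
  RG-smaller {k} (new r) (Fin.suc j) d 1≤d d<c with RG-smaller r j d 1≤d d<c
  ... | inj₂ (i , i<j , refl) = inj₂ (Fin.suc i , s≤s i<j , refl)
  ... | inj₁ d≤1+k with d ℕ.≟ suc k
  ...   | yes refl = inj₂ (Fin.zero , s≤s z≤n , refl)
  ...   | no  d≢   = inj₁ (ℕ.≤-pred (ℕ.≤∧≢⇒< d≤1+k d≢))

  Smaller-head : ∀ {k c w} → Smaller k (c ∷ w) Fin.zero → c ≤ suc k
  Smaller-head {k} {c} {w} smaller = ℕ.≮⇒≥ λ 1+k<c → absurd (smaller (suc k) (s≤s z≤n) 1+k<c)
    where
    absurd : ¬ (suc k ≤ k ⊎ ∃[ i ] i Fin.< Fin.zero {length w} × lookup (c ∷ w) i ≡ suc k)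
    absurd (inj₁ 1+k≤k) = ℕ.1+n≰n 1+k≤k
    absurd (inj₂ (_ , () , _))

  Smaller-tail : ∀ {k k′ c w j} → k ≤ k′ → c ≤ k′ → Smaller k (c ∷ w) (Fin.suc j) → Smaller k′ w j
  Smaller-tail k≤k′ c≤k′ smaller d 1≤d d<c with smaller d 1≤d d<c
  ... | inj₁ d≤k                           = inj₁ (ℕ.≤-trans d≤k k≤k′)
  ... | inj₂ (Fin.zero , _ , refl)         = inj₁ c≤k′
  ... | inj₂ (Fin.suc i , s≤s i<j , eq)    = inj₂ (i , i<j , eq)

  RG-from-smaller : ∀ w k → (∀ j → 1 ≤ lookup w j) → (∀ j → Smaller k w j) → ∃[ k′ ] RG k w k′
  RG-from-smaller []      k _        _       = k , done
  RG-from-smaller (c ∷ w) k positive smaller with c ℕ.≤? k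
  ... | yes c≤k with k′ , r ← RG-from-smaller w k (positive ∘ Fin.suc) (λ j → Smaller-tail ℕ.≤-refl c≤k (smaller (Fin.suc j))) =
    k′ , old (positive Fin.zero) c≤k r
  ... | no  c≰k with refl ← ℕ.≤-antisym (ℕ.≰⇒> c≰k) (Smaller-head (smaller Fin.zero))
    with k′ , r ← RG-from-smaller w (suc k) (positive ∘ Fin.suc) (λ j → Smaller-tail (ℕ.n≤1+n k) ℕ.≤-refl (smaller (Fin.suc j))) =
    k′ , new r

  firstOccurrence : ∀ {w d} → d ∈ w → ∃[ i ] lookup w i ≡ d × IsBlockMin w i
  firstOccurrence {c ∷ w} {d} d∈ with c ℕ.≟ d
  ... | yes refl = Fin.zero , refl , λ _ _ → z≤n
  firstOccurrence {c ∷ w} {d} (here refl) | no c≢d = ⊥-elim (c≢d refl)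
  firstOccurrence {c ∷ w} {d} (there d∈)  | no c≢d with i , refl , min ← firstOccurrence d∈ =
    Fin.suc i , refl , λ { Fin.zero eq → ⊥-elim (c≢d eq) ; (Fin.suc j) eq → s≤s (min j eq) }

  -- A letter `d` below the one at `j` occurs because the letters form an interval, and its first
  -- occurrence precedes `j` because block minima increase with the letters.
  canonical⇒RG : ∀ {w} → IsCanonical w → ∃[ k ] RG 0 w k
  canonical⇒RG {w} canonical = RG-from-smaller w 0 positive λ j d 1≤d d<c → inj₂ (smaller j d 1≤d d<c)
    where
    open IsCanonical canonical
    positive : ∀ j → 1 ≤ lookup w j
    positive j = proj₁ (to (letters _) (∈-lookup j))

    smaller : ∀ j d → 1 ≤ d → d < lookup w j → ∃[ i ] i Fin.< j × lookup w i ≡ d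
    smaller j d 1≤d d<c
      with i , refl , i-min ← firstOccurrence {w} {d} (from (letters d)
             (1≤d , ℕ.≤-trans (ℕ.<⇒≤ d<c) (proj₂ (to (letters _) (∈-lookup {xs = w} j)))))
      with j′ , eq , j′-min ← firstOccurrence {w} (∈-lookup {xs = w} j) =
      i , ℕ.≤-trans (ordered i j′ i-min j′-min (≡.subst (lookup w i <_) (≡.sym eq) d<c)) (j′-min j (≡.sym eq)) , refl

  RG⇒canonical : ∀ {w k} → RG 0 w k → IsCanonical w
  RG⇒canonical {w} {k} r = record
    { blockCount = k
    ; letters    = λ c → mk⇔ (RG-∈⁻ r) λ (1≤c , c≤k) → RG-∈⁺ r 1≤c c≤k
    ; ordered    = ordered
    }
    where
    ordered : ∀ i j → IsBlockMin w i → IsBlockMin w j → lookup w i < lookup w j → i Fin.< j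
    ordered i j i-min _ lt with RG-smaller r j (lookup w i) (proj₁ (RG-∈⁻ r (∈-lookup i))) lt
    ... | inj₁ ≤0 = ⊥-elim (ℕ.<⇒≱ (proj₁ (RG-∈⁻ r (∈-lookup i))) ≤0)
    ... | inj₂ (i′ , i′<j , eq) = ℕ.≤-<-trans (i-min i′ eq) i′<j

-- The shape of `β` inside a word: being empty or starting with 1, it begins exactly where `α + 1`,
-- which is free of 1, ends.
data EmptyOrOne : Word → Set where
  []   : EmptyOrOne []
  one∷ : ∀ w → EmptyOrOne (1 ∷ w)

encode-positive : ∀ t {c} → c ∈ encode t → 1 ≤ c
encode-positive t c∈ = proj₁ (RG-∈⁻ (RG-encode t) c∈)

encode-map-suc-≢1 : ∀ t → All (1 ≢_) (map suc (encode t))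
encode-map-suc-≢1 t = All.map⁺ (All.tabulate λ c∈ eq → ℕ.<⇒≢ (encode-positive t c∈) (ℕ.suc-injective eq))

makeRoom-encode-head : ∀ k t → EmptyOrOne (map (makeRoom k) (encode t))
makeRoom-encode-head k leaf       = []
makeRoom-encode-head k (node _ _) = one∷ _

split-unique : ∀ {u u′ v v′} → All (1 ≢_) u → All (1 ≢_) u′ → EmptyOrOne v → EmptyOrOne v′ →
  u ++ v ≡ u′ ++ v′ → u ≡ u′ × v ≡ v′
split-unique []        []        _        _        eq   = refl , eq
split-unique []        (ne ∷ _)  (one∷ _) _        refl = ⊥-elim (ne refl)
split-unique (ne ∷ _)  []        _        (one∷ _) refl = ⊥-elim (ne refl)
split-unique (_ ∷ ps)  (_ ∷ qs)  p        q        eq with refl , eq′ ← ∷-injective eq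
  with refl , eq″ ← split-unique ps qs p q eq′ = refl , eq″

-- Both tails are cut at their first 1. The left subtrees have to be identified before the right
-- ones, since the relabelling of the right part depends on `blocks l`.
encode-injective : ∀ {s t} → encode s ≡ encode t → s ≡ t
encode-injective {leaf}     {leaf}       _  = refl
encode-injective {node l r} {node l′ r′} eq
  with eql , eqr ← split-unique (encode-map-suc-≢1 l) (encode-map-suc-≢1 l′)
         (makeRoom-encode-head _ r) (makeRoom-encode-head _ r′) (∷-injectiveʳ eq)
  with refl ← encode-injective {l} {l′} (map-injective ℕ.suc-injective eql)
  with refl ← encode-injective {r} {r′} (map-injective (makeRoom-injective (blocks l)) eqr) = refl

-- Crossings under concatenation and relabelling.

⊆-++⁻ : ∀ {A : Set} {zs : List A} xs {ys} → zs ⊆ xs ++ ys →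
  ∃[ us ] ∃[ vs ] zs ≡ us ++ vs × us ⊆ xs × vs ⊆ ys
⊆-++⁻ []       s          = [] , _ , refl , [] , s
⊆-++⁻ (x ∷ xs) (.x ∷ʳ s)  with us , vs , refl , p , q ← ⊆-++⁻ xs s = us , vs , refl , x ∷ʳ p , q
⊆-++⁻ (x ∷ xs) (refl ∷ s) with us , vs , refl , p , q ← ⊆-++⁻ xs s = x ∷ us , vs , refl , refl ∷ p , q

∈-⊆-there : ∀ {A : Set} {x y : A} {xs ys} → x ∷ y ∷ xs ⊆ ys → y ∈ ys
∈-⊆-there s = ⊆-lookup s (there (here refl))

-- A pattern `a b a b` that is cut by the boundary, wherever the cut is, has `a` or `b` on both
-- sides.
nonCrossing-++ : ∀ {u v} → NonCrossing u → NonCrossing v → (∀ {c} → c ∈ u → c ∉ v) → NonCrossing (u ++ v)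
nonCrossing-++ {u} nu nv disjoint a b a<b s with ⊆-++⁻ u s
... | []             , _ , refl , _ , q = nv a b a<b q
... | _ ∷ []         , _ , refl , p , q = disjoint (⊆-lookup p (here refl)) (∈-⊆-there q)
... | _ ∷ _ ∷ []     , _ , refl , p , q = disjoint (⊆-lookup p (here refl)) (⊆-lookup q (here refl))
... | _ ∷ _ ∷ _ ∷ [] , _ , refl , p , q = disjoint (∈-⊆-there p) (⊆-lookup q (here refl))
... | _ ∷ _ ∷ _ ∷ _ ∷ [] , [] , refl , p , q = nu a b a<b p

-- The new case is a crossing whose first letter is the initial 1. The rest `b 1 b` cannot use a 1
-- of `u`, and if it lies in `v`, then the 1 that `v` starts with can replace the initial one.
nonCrossing-one∷ : ∀ {u v} → NonCrossing u → NonCrossing v → (∀ {c} → c ∈ u → c ∉ v) →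
  All (1 ≢_) u → EmptyOrOne v → NonCrossing (1 ∷ u ++ v)
nonCrossing-one∷ nu nv disjoint 1∉u head a b a<b (.1 ∷ʳ s) = nonCrossing-++ nu nv disjoint a b a<b s
nonCrossing-one∷ {u} nu nv disjoint 1∉u head .1 b a<b (refl ∷ s) with ⊆-++⁻ u s
... | _ ∷ []         , _ , refl , p , q = disjoint (⊆-lookup p (here refl)) (∈-⊆-there q)
... | _ ∷ _ ∷ []     , _ , refl , p , q = All.lookup 1∉u (∈-⊆-there p) refl
... | _ ∷ _ ∷ _ ∷ [] , _ , refl , p , q = All.lookup 1∉u (∈-⊆-there p) refl
... | []             , _ , refl , p , q with head
...   | one∷ _ with q
...     | .1 ∷ʳ q′   = nv 1 b a<b (refl ∷ q′)
...     | refl ∷ q′  = ℕ.<-irrefl refl a<b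

nonCrossing-map⁺ : ∀ {f w} → StrictlyMonotone f → NonCrossing w → NonCrossing (map f w)
nonCrossing-map⁺ {f} {w} mono nc a b a<b s
  with a′ , a′∈ , refl ← ∈-map⁻ f (⊆-lookup s (here refl))
  with b′ , b′∈ , refl ← ∈-map⁻ f (∈-⊆-there s) with ℕ.<-cmp a′ b′
... | tri< a′<b′ _ _ = nc a′ b′ a′<b′ (⊆-map⁻ (a′ ∷ b′ ∷ a′ ∷ b′ ∷ []) s)
  where
  ⊆-map⁻ : ∀ us {w} → map f us ⊆ map f w → us ⊆ w
  ⊆-map⁻ [] {[]} s = []
  ⊆-map⁻ [] {x ∷ w} (_ ∷ʳ s) = x ∷ʳ ⊆-map⁻ [] s
  ⊆-map⁻ (u ∷ us) {x ∷ w} (_ ∷ʳ s) = x ∷ʳ ⊆-map⁻ (u ∷ us) s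
  ⊆-map⁻ (u ∷ us) {x ∷ w} (eq ∷ s) = mono-injective mono eq ∷ ⊆-map⁻ us s
... | tri≈ _ refl _ = ⊥-elim (ℕ.<-irrefl refl a<b)
... | tri> _ _ b′<a′ = ⊥-elim (ℕ.<-asym a<b (mono b′<a′))

nonCrossing-map⁻ : ∀ {f w} → StrictlyMonotone f → NonCrossing (map f w) → NonCrossing w
nonCrossing-map⁻ {f} mono nc a b a<b s = nc (f a) (f b) (mono a<b) (Sublist.map⁺ f s)

nonCrossing-⊆ : ∀ {u w} → u ⊆ w → NonCrossing w → NonCrossing u
nonCrossing-⊆ u⊆w nc a b a<b s = nc a b a<b (⊆-trans s u⊆w)

makeRoom-positive : ∀ k {c} → 1 ≤ c → makeRoom k c ≡ 1 ⊎ suc k < makeRoom k c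
makeRoom-positive k {1}           _ = inj₁ refl
makeRoom-positive k {suc (suc c)} _ = inj₂ (s≤s (s≤s (ℕ.m≤m+n k c)))

nonCrossing-encode : ∀ t → NonCrossing (encode t)
nonCrossing-encode leaf a b _ ()
nonCrossing-encode (node l r) = nonCrossing-one∷
  (nonCrossing-map⁺ s≤s (nonCrossing-encode l))
  (nonCrossing-map⁺ (λ {c} {d} → makeRoom-mono (blocks l) {c} {d}) (nonCrossing-encode r))
  disjoint (encode-map-suc-≢1 l) (makeRoom-encode-head _ r)
  where
  disjoint : ∀ {c} → c ∈ map suc (encode l) → c ∉ map (makeRoom (blocks l)) (encode r)
  disjoint c∈l c∈r with c , c∈ , refl ← ∈-map⁻ suc c∈l with d , d∈ , eq ← ∈-map⁻ (makeRoom (blocks l)) c∈r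
    with 1≤c , c≤k ← RG-∈⁻ (RG-encode l) c∈ with makeRoom-positive (blocks l) (encode-positive r d∈)
  ... | inj₁ ≡1   = ℕ.<⇒≢ 1≤c (≡.sym (ℕ.suc-injective (≡.trans eq ≡1)))
  ... | inj₂ k<   = ℕ.<⇒≱ k< (≡.subst (_≤ suc (blocks l)) eq (s≤s c≤k))

splitAtOne : ∀ w → ∃[ u ] ∃[ v ] w ≡ u ++ v × All (1 ≢_) u × EmptyOrOne v
splitAtOne []      = [] , [] , refl , [] , []
splitAtOne (c ∷ w) with 1 ℕ.≟ c
... | yes refl = [] , 1 ∷ w , refl , [] , one∷ w
... | no  1≢c  with u , v , refl , 1∉u , head ← splitAtOne w = c ∷ u , v , refl , 1≢c ∷ 1∉u , head

-- A letter of `v` between 2 and `suc k` also occurs in `u`, and together with the two ones it would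
-- give the crossing `1 c 1 c`. This is what makes the letters of `β` fit the image of `makeRoom`.
letters-after-return : ∀ {u v k} → NonCrossing (1 ∷ u ++ 1 ∷ v) → RestrictedGrowth 1 u (suc k) →
  (∀ {c} → c ∈ v → 1 ≤ c) → ∀ {c} → c ∈ v → c ≡ 1 ⊎ suc k < c
letters-after-return {u} {v} {k} nc ru positive {c} c∈ with c ℕ.≟ 1 | suc k ℕ.<? c
... | yes c≡1 | _       = inj₁ c≡1
... | no  _   | yes k<c = inj₂ k<c
... | no  c≢1 | no  k≮c = ⊥-elim (nc 1 c 1<c (refl ∷ Sublist.++⁺
        (from∈ (RG-∈⁺ ru 1<c (ℕ.≮⇒≥ k≮c))) (refl ∷ from∈ c∈)))
  where
  1<c : 1 < c
  1<c = ℕ.≤∧≢⇒< (positive c∈) (c≢1 ∘ ≡.sym)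

-- The word after the initial 1 is cut at its next 1. The induction is on a bound for the length,
-- because the two parts are relabelled before they are parsed.
parse : ∀ n w {k} → length w ≤ n → RestrictedGrowth 0 w k → NonCrossing w → ∃[ t ] w ≡ encode t
parse n       []      _        _            _  = leaf , refl
parse (suc n) (c ∷ w) _        (old (s≤s _) () _) _
parse (suc n) (1 ∷ w) (s≤s le) (new r)      nc
  with u , v , refl , 1∉u , head ← splitAtOne w
  with k₁ , ru , rv ← RG-++⁻ u r
  with u′ , k , refl , refl , ru′ ← RG-suc⁻ ru 1∉u
  with l , refl ← parse n u′
         (ℕ.≤-trans (≡.subst (_≤ length (map suc u′ ++ v)) (length-map suc u′)
            (≡.subst (length (map suc u′) ≤_) (≡.sym (length-++ (map suc u′))) (ℕ.m≤m+n _ _))) le)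
         ru′ (nonCrossing-map⁻ s≤s (nonCrossing-⊆ (1 ∷ʳ Sublist.++⁺ʳ v ⊆-refl) nc))
  -- A word determines its number of blocks, so the count obtained for the left part is `blocks l`,
  -- the room that the encoding leaves.
  with refl ← RG-functional ru′ (RG-encode l)
  with head
... | [] = node l leaf , refl
... | one∷ v₁ with rv
...   | old _ _ rv₁
  with v₁′ , j , refl , rv₁′ ← RG-makeRoom⁻ (blocks l) {0}
         (≡.subst (λ n → RestrictedGrowth (suc n) v₁ _) (≡.sym (ℕ.+-identityʳ (blocks l))) rv₁)
         (All.tabulate (letters-after-return nc ru (λ c∈ → proj₁ (RG-∈⁻ rv₁ c∈))))
  with t , eq ← parse n (1 ∷ v₁′)
         (ℕ.≤-trans (≡.subst (_≤ length (map suc (encode l) ++ 1 ∷ map (makeRoom (blocks l)) v₁′)) (length-map (makeRoom (blocks l)) (1 ∷ v₁′))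
            (≡.subst (length (1 ∷ map (makeRoom (blocks l)) v₁′) ≤_) (≡.sym (length-++ (map suc (encode l)))) (ℕ.m≤n+m _ _))) le)
         (new rv₁′)
         (nonCrossing-map⁻ (λ {c} {d} → makeRoom-mono (blocks l) {c} {d}) (nonCrossing-⊆ (1 ∷ʳ Sublist.++⁺ˡ (map suc (encode l)) ⊆-refl) nc)) =
  node l t , ≡.cong (λ v → 1 ∷ map suc (encode l) ++ map (makeRoom (blocks l)) v) eq

-- The list of non-crossing partitions compared with the list of trees.

wordsOver-∈⁺ : ∀ {letters} w → All (_∈ letters) w → w ∈ wordsOver letters (length w)
wordsOver-∈⁺ []      []       = here refl
wordsOver-∈⁺ (c ∷ w) (p ∷ ps) = ∈-cartesianProductWith⁺ _∷_ p (wordsOver-∈⁺ w ps)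

wordsOver-length : ∀ letters n {w} → w ∈ wordsOver letters n → length w ≡ n
wordsOver-length letters zero    (here refl) = refl
wordsOver-length letters (suc n) w∈
  with _ , v , _ , v∈ , refl ← ∈-cartesianProductWith⁻ _∷_ letters (wordsOver letters n) w∈ =
  ≡.cong suc (wordsOver-length letters n v∈)

wordsOver-unique : ∀ {letters} n → Unique letters → Unique (wordsOver letters n)
wordsOver-unique zero    _  = [] AllPairs.∷ AllPairs.[]
wordsOver-unique (suc n) us = Unique.cartesianProductWith⁺ _∷_ ∷-injective us (wordsOver-unique n us)

canonicalNonCrossing? : ∀ π → Dec (IsCanonical π × NonCrossing π)
canonicalNonCrossing? π = isCanonical? π ×-dec nonCrossing? π

NC-unique : ∀ n → Unique (NC n)
NC-unique n = Unique.filter⁺ canonicalNonCrossing?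
  (wordsOver-unique n (Unique.map⁺ ℕ.suc-injective (Unique.upTo⁺ n)))

canonicalNonCrossing⇒encode : ∀ {w} → IsCanonical w → NonCrossing w → ∃[ t ] w ≡ encode t
canonicalNonCrossing⇒encode canonical nc = parse _ _ ℕ.≤-refl (proj₂ (canonical⇒RG canonical)) nc

NC⇒encode : ∀ n {w} → w ∈ NC n → w ∈ map encode (trees n n)
NC⇒encode n w∈ with w∈′ , canonical , nc ← ∈-filter⁻ canonicalNonCrossing? {xs = wordsOver (map suc (upTo n)) n} w∈
  with t , refl ← canonicalNonCrossing⇒encode canonical nc
  with refl ← ≡.trans (≡.sym (length-encode t)) (wordsOver-length _ n w∈′) =
  ∈-map⁺ encode (∈-trees⁺ t ℕ.≤-refl)

encode⇒NC : ∀ n {w} → w ∈ map encode (trees n n) → w ∈ NC n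
encode⇒NC n w∈ with t , t∈ , refl ← ∈-map⁻ encode w∈ with refl ← ∈-trees⁻ n n t∈ =
  ∈-filter⁺ canonicalNonCrossing?
    (≡.subst (λ n → encode t ∈ wordsOver (map suc (upTo (size t))) n) (length-encode t) (wordsOver-∈⁺ (encode t) (All.tabulate letter)))
    (RG⇒canonical (RG-encode t) , nonCrossing-encode t)
  where
  letter : ∀ {c} → c ∈ encode t → c ∈ map suc (upTo (size t))
  -- A letter is at most the number of blocks, which is at most the length of the word.
  letter {suc c} c∈ = ∈-map⁺ suc (∈-upTo⁺ (ℕ.≤-trans (proj₂ (RG-∈⁻ (RG-encode t) c∈))
    (≡.subst (blocks t ≤_) (length-encode t) (RG-length (RG-encode t)))))
  letter {zero} c∈ with () ← encode-positive t c∈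

-- Order isomorphism

iso-intro : ∀ {us vs} → length us ≡ length vs →
  (∀ {p r} → p ∈ zip us vs → r ∈ zip us vs → SameOrder p r) → OrderIsomorphic us vs
iso-intro len same = len , All.tabulate λ p∈ → All.tabulate λ r∈ → same p∈ r∈

iso-sameOrder : ∀ {us vs} → OrderIsomorphic us vs → ∀ {p r} → p ∈ zip us vs → r ∈ zip us vs → SameOrder p r
iso-sameOrder (_ , same) p∈ r∈ = All.lookup (All.lookup same p∈) r∈

zip-partnerˡ : ∀ {us vs : Word} {u} → length us ≡ length vs → u ∈ us → ∃[ v ] v ∈ vs × (u , v) ∈ zip us vs
zip-partnerˡ {_ ∷ _} {v ∷ _} _   (here refl) = v , here refl , here refl
zip-partnerˡ {_ ∷ _} {_ ∷ _} len (there u∈)  with v , v∈ , p ← zip-partnerˡ (ℕ.suc-injective len) u∈ = v , there v∈ , there p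

zip-swap : ∀ {us vs : Word} {u v} → (u , v) ∈ zip us vs → (v , u) ∈ zip vs us
zip-swap {_ ∷ _} {_ ∷ _} (here refl) = here refl
zip-swap {_ ∷ _} {_ ∷ _} (there p)   = there (zip-swap p)

zip-partnerʳ : ∀ {us vs : Word} {v} → length us ≡ length vs → v ∈ vs → ∃[ u ] u ∈ us × (u , v) ∈ zip us vs
zip-partnerʳ {us} {vs} len v∈ with u , u∈ , p ← zip-partnerˡ {vs} {us} (≡.sym len) v∈ = u , u∈ , zip-swap {vs} {us} p

zip-∈ˡ : ∀ {us vs : Word} {u v} → (u , v) ∈ zip us vs → u ∈ us
zip-∈ˡ {_ ∷ _} {_ ∷ _} (here refl) = here refl
zip-∈ˡ {_ ∷ _} {_ ∷ _} (there p)   = there (zip-∈ˡ p)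

zip-∈ʳ : ∀ {us vs : Word} {u v} → (u , v) ∈ zip us vs → v ∈ vs
zip-∈ʳ {us} {vs} p = zip-∈ˡ (zip-swap {us} {vs} p)

zip-map⁺ : ∀ {us vs : Word} {u v} (f : ℕ → ℕ) → (u , v) ∈ zip us vs → (f u , v) ∈ zip (map f us) vs
zip-map⁺ {_ ∷ _} {_ ∷ _} f (here refl) = here refl
zip-map⁺ {_ ∷ _} {_ ∷ _} f (there p)   = there (zip-map⁺ f p)

zip-map⁻ : ∀ {us vs : Word} {u v} (f : ℕ → ℕ) → (u , v) ∈ zip (map f us) vs → ∃[ u′ ] u ≡ f u′ × (u′ , v) ∈ zip us vs
zip-map⁻ {u′ ∷ _} {_ ∷ _} f (here refl) = u′ , refl , here refl
zip-map⁻ {_ ∷ _} {_ ∷ _} f (there p) with u′ , refl , p′ ← zip-map⁻ f p = u′ , refl , there p′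

mono-<⁻ : ∀ {f} → StrictlyMonotone f → ∀ {c d} → f c < f d → c < d
mono-<⁻ mono {c} {d} lt with ℕ.<-cmp c d
... | tri< c<d _ _ = c<d
... | tri≈ _ refl _ = ⊥-elim (ℕ.<-irrefl refl lt)
... | tri> _ _ d<c  = ⊥-elim (ℕ.<-asym lt (mono d<c))

sameOrder-map : ∀ {f} → StrictlyMonotone f → ∀ {c d v w} →
  SameOrder (c , v) (d , w) ⇔ SameOrder (f c , v) (f d , w)
sameOrder-map {f} mono = mk⇔
  (λ (lt , eq) → mk⇔ (to lt ∘ mono-<⁻ mono) (mono ∘ from lt) , mk⇔ (to eq ∘ mono-injective mono) (≡.cong f ∘ from eq))
  (λ (lt , eq) → mk⇔ (to lt ∘ mono) (mono-<⁻ mono ∘ from lt) , mk⇔ (to eq ∘ ≡.cong f) (mono-injective mono ∘ from eq))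

iso-map⁺ : ∀ {f us vs} → StrictlyMonotone f → OrderIsomorphic us vs → OrderIsomorphic (map f us) vs
iso-map⁺ {f} {us} {vs} mono iso = iso-intro (≡.trans (length-map f us) (proj₁ iso)) same
  where
  same : ∀ {p r} → p ∈ zip (map f us) vs → r ∈ zip (map f us) vs → SameOrder p r
  same p∈ r∈ = transport (zip-map⁻ {us} {vs} f p∈) (zip-map⁻ {us} {vs} f r∈)
    where
    transport : ∀ {c v d w} → ∃[ c′ ] c ≡ f c′ × (c′ , v) ∈ zip us vs → ∃[ d′ ] d ≡ f d′ × (d′ , w) ∈ zip us vs →
      SameOrder (c , v) (d , w)
    transport (_ , refl , p∈′) (_ , refl , r∈′) = to (sameOrder-map mono) (iso-sameOrder iso p∈′ r∈′)

iso-map⁻ : ∀ {f us vs} → StrictlyMonotone f → OrderIsomorphic (map f us) vs → OrderIsomorphic us vs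
iso-map⁻ {f} {us} {vs} mono iso = iso-intro (≡.trans (≡.sym (length-map f us)) (proj₁ iso))
  λ p∈ r∈ → from (sameOrder-map mono) (iso-sameOrder iso (zip-map⁺ f p∈) (zip-map⁺ f r∈))

iso-sym : ∀ {us vs} → OrderIsomorphic us vs → OrderIsomorphic vs us
iso-sym {us} {vs} iso = iso-intro (≡.sym (proj₁ iso)) same
  where
  same : ∀ {p r} → p ∈ zip vs us → r ∈ zip vs us → SameOrder p r
  same p∈ r∈ = let lt , eq = iso-sameOrder iso (zip-swap {vs} {us} p∈) (zip-swap {vs} {us} r∈) in
    mk⇔ (from lt) (to lt) , mk⇔ (from eq) (to eq)

zip-self : ∀ {us : Word} {u v} → (u , v) ∈ zip us us → u ≡ v
zip-self {_ ∷ _} (here refl) = refl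
zip-self {_ ∷ _} (there p)   = zip-self p

iso-refl : ∀ us → OrderIsomorphic us us
iso-refl us = iso-intro refl same
  where
  same : ∀ {p r} → p ∈ zip us us → r ∈ zip us us → SameOrder p r
  same p∈ r∈ with refl ← zip-self {us} p∈ with refl ← zip-self {us} r∈ = mk⇔ id id , mk⇔ id id

zip-++ˡ : ∀ {us us′ vs vs′ : Word} {p} → length us ≡ length vs → p ∈ zip us vs → p ∈ zip (us ++ us′) (vs ++ vs′)
zip-++ˡ {_ ∷ _} {vs = _ ∷ _} _   (here refl) = here refl
zip-++ˡ {_ ∷ _} {vs = _ ∷ _} len (there p)   = there (zip-++ˡ (ℕ.suc-injective len) p)

zip-++ʳ : ∀ (us : Word) {us′} (vs : Word) {vs′ : Word} {p} → length us ≡ length vs → p ∈ zip us′ vs′ → p ∈ zip (us ++ us′) (vs ++ vs′)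
zip-++ʳ []       []       _   p = p
zip-++ʳ (_ ∷ us) (_ ∷ vs) len p = there (zip-++ʳ us vs (ℕ.suc-injective len) p)

zip-++⁻ : ∀ (us : Word) {us′} (vs : Word) {vs′ : Word} {p} → length us ≡ length vs → p ∈ zip (us ++ us′) (vs ++ vs′) →
          p ∈ zip us vs ⊎ p ∈ zip us′ vs′
zip-++⁻ []       []       _   p        = inj₂ p
zip-++⁻ (_ ∷ _)  (_ ∷ _)  _   (here e) = inj₁ (here e)
zip-++⁻ (_ ∷ us) (_ ∷ vs) len (there p) with zip-++⁻ us vs (ℕ.suc-injective len) p
... | inj₁ q = inj₁ (there q)
... | inj₂ q = inj₂ q

-- Descent along the letters below x, all of which occur in u.
iso-≤ : ∀ {u v} → OrderIsomorphic u v →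
  (∀ {c d} → c ∈ u → 1 ≤ d → d < c → d ∈ u) → (∀ {c} → c ∈ v → 1 ≤ c) →
  ∀ x {y} → (x , y) ∈ zip u v → x ≤ y
iso-≤ iso closed positive 0 _ = z≤n
iso-≤ {u} {v} iso closed positive 1 p = positive (zip-∈ʳ {u} {v} p)
iso-≤ {u} {v} iso closed positive (suc (suc d)) p =
  let y , _ , r = zip-partnerˡ {u} {v} (proj₁ iso) (closed (zip-∈ˡ {u} {v} p) (s≤s z≤n) (ℕ.n<1+n (suc d))) in
  ℕ.≤-<-trans (iso-≤ iso closed positive (suc d) r) (to (proj₁ (iso-sameOrder iso r p)) (ℕ.n<1+n (suc d)))

zip-≡ : ∀ {u v : Word} → length u ≡ length v → (∀ {x y} → (x , y) ∈ zip u v → x ≡ y) → u ≡ v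
zip-≡ {[]}    {[]}    _   _  = refl
zip-≡ {_ ∷ _} {_ ∷ _} len eq = ≡.cong₂ _∷_ (eq (here refl)) (zip-≡ (ℕ.suc-injective len) (eq ∘ there))

encode-downClosed : ∀ t {c d} → c ∈ encode t → 1 ≤ d → d < c → d ∈ encode t
encode-downClosed t c∈ 1≤d d<c =
  RG-∈⁺ (RG-encode t) 1≤d (ℕ.≤-trans (ℕ.<⇒≤ d<c) (proj₂ (RG-∈⁻ (RG-encode t) c∈)))

-- The letters of each word fill an interval starting at 1, so comparing ranks bounds each letter by
-- its partner in both directions.
iso-encode : ∀ {s t} → OrderIsomorphic (encode s) (encode t) → s ≡ t
iso-encode {s} {t} iso = encode-injective (zip-≡ (proj₁ iso) λ {x} {y} p → ℕ.≤-antisym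
  (iso-≤ iso (encode-downClosed s) (encode-positive t) x p)
  (iso-≤ (iso-sym iso) (encode-downClosed t) (encode-positive s) y (zip-swap {encode s} {encode t} p)))

-- If the two cuts do not align, a pair of letters witnesses it. When the first cut comes too early,
-- the witness involves the letter `h` just after it, which will be the 1 at the start of `β`.
zip-++-trichotomy : ∀ (us : Word) {h us′} (vs : Word) {vs′ : Word} → length (us ++ h ∷ us′) ≡ length (vs ++ vs′) →
    length us ≡ length vs
  ⊎ (∃[ x ] ∃[ y ] x ∈ us × y ∈ vs′ × (x , y) ∈ zip (us ++ h ∷ us′) (vs ++ vs′))
  ⊎ (∃[ y ] y ∈ vs × (h , y) ∈ zip (us ++ h ∷ us′) (vs ++ vs′))
zip-++-trichotomy []       []                _ = inj₁ refl
zip-++-trichotomy []       (y ∷ vs)          _ = inj₂ (inj₂ (y , here refl , here refl))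
zip-++-trichotomy (x ∷ us) [] {vs′ = y ∷ _}  _ = inj₂ (inj₁ (x , y , here refl , here refl , here refl))
zip-++-trichotomy (_ ∷ us) (_ ∷ vs) len with zip-++-trichotomy us vs (ℕ.suc-injective len)
... | inj₁ eq                          = inj₁ (≡.cong suc eq)
... | inj₂ (inj₁ (x , y , x∈ , y∈ , p)) = inj₂ (inj₁ (x , y , there x∈ , y∈ , there p))
... | inj₂ (inj₂ (y , y∈ , p))          = inj₂ (inj₂ (y , there y∈ , there p))

-- Occurrences of the pattern

ind-⇔ : ∀ {A B : Set} (a : Dec A) (b : Dec B) → (A → B) → (B → A) → ind a ≡ ind b
ind-⇔ (yes _)  (yes _)  _ _ = refl
ind-⇔ (no _)   (no _)   _ _ = refl
ind-⇔ (yes a)  (no ¬b)  f _ = ⊥-elim (¬b (f a))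
ind-⇔ (no ¬a)  (yes b)  _ g = ⊥-elim (¬a (g b))

ind-no : ∀ {A : Set} (a : Dec A) → ¬ A → ind a ≡ 0
ind-no (yes a) ¬a = ⊥-elim (¬a a)
ind-no (no _)  _  = refl

length-filter-∷ : ∀ {A : Set} {P : A → Set} (P? : Decidable P) x xs →
  length (filter P? (x ∷ xs)) ≡ ind (P? x) ℕ.+ length (filter P? xs)
length-filter-∷ P? x xs with P? x
... | yes _ = refl
... | no  _ = refl

length-filter-applyUpTo : ∀ {A : Set} {P : A → Set} (P? : Decidable P) (f : ℕ → A) n →
  length (filter P? (applyUpTo f n)) ≡ length (filter (P? ∘ f) (upTo n))
length-filter-applyUpTo P? f zero    = refl
length-filter-applyUpTo P? f (suc n) = begin
  length (filter P? (f 0 ∷ applyUpTo (f ∘ suc) n))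
    ≡⟨ length-filter-∷ P? (f 0) _ ⟩
  ind (P? (f 0)) ℕ.+ length (filter P? (applyUpTo (f ∘ suc) n))
    ≡⟨ ≡.cong (ind (P? (f 0)) ℕ.+_) (length-filter-applyUpTo P? (f ∘ suc) n) ⟩
  ind (P? (f 0)) ℕ.+ length (filter (P? ∘ f ∘ suc) (upTo n))
    ≡⟨ ≡.cong (ind (P? (f 0)) ℕ.+_) (length-filter-applyUpTo (P? ∘ f) suc n) ⟨
  ind (P? (f 0)) ℕ.+ length (filter (P? ∘ f) (applyUpTo suc n))
    ≡⟨ length-filter-∷ (P? ∘ f) 0 _ ⟨
  length (filter (P? ∘ f) (upTo (suc n))) ∎
  where open ≡.≡-Reasoning

iso-take-short : ∀ {u v} → length u < length v → ¬ OrderIsomorphic (take (length v) u) v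
iso-take-short {u} {v} lt iso = ℕ.<⇒≢ lt (≡.trans (≡.cong length (≡.sym (take-all (length v) u (ℕ.<⇒≤ lt)))) (proj₁ iso))

-- The count `μ` as a recursion on the word. Windows near the end are cut short by `take` and then
-- have the wrong length to match.
occurrences : Word → Word → ℕ
occurrences τ []      = 0
occurrences τ (c ∷ w) = ind (orderIsomorphic? (take (length τ) (c ∷ w)) τ) ℕ.+ occurrences τ w

-- The pattern is nonempty here: for the empty pattern `μ` would also count the position past the
-- end.
μ≡occurrences : ∀ c τ w → μ (c ∷ τ) w ≡ occurrences (c ∷ τ) w
μ≡occurrences c τ [] = ≡.cong (λ n → length (filter (λ i → orderIsomorphic? (take (suc (length τ)) (drop i [])) (c ∷ τ)) (upTo n))) (ℕ.0∸n≡0 (length τ))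
μ≡occurrences c τ (d ∷ w) = ≡.trans (step (length τ ℕ.≤? length w)) (≡.cong (ind (at? 0) ℕ.+_) (μ≡occurrences c τ w))
  where
  at? : ∀ i → Dec (OrderIsomorphic (take (suc (length τ)) (drop i (d ∷ w))) (c ∷ τ))
  at? i = orderIsomorphic? (take (suc (length τ)) (drop i (d ∷ w))) (c ∷ τ)

  step : Dec (length τ ≤ length w) → μ (c ∷ τ) (d ∷ w) ≡ ind (at? 0) ℕ.+ μ (c ∷ τ) w
  step (yes le) = begin
    length (filter at? (upTo (suc (length w) ∸ length τ)))      ≡⟨ ≡.cong (λ n → length (filter at? (upTo n))) (ℕ.+-∸-assoc 1 le) ⟩
    length (filter at? (upTo (suc (length w ∸ length τ))))      ≡⟨ length-filter-∷ at? 0 _ ⟩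
    ind (at? 0) ℕ.+ length (filter at? (applyUpTo suc (length w ∸ length τ)))
      ≡⟨ ≡.cong (ind (at? 0) ℕ.+_) (length-filter-applyUpTo at? suc (length w ∸ length τ)) ⟩
    ind (at? 0) ℕ.+ μ (c ∷ τ) w ∎
    where open ≡.≡-Reasoning
  -- No window fits: both truncated differences are 0, and the shortened window at position 0 does
  -- not match.
  step (no ≰) = ≡.trans (≡.cong (λ n → length (filter at? (upTo n))) (ℕ.m≤n⇒m∸n≡0 (ℕ.≰⇒> ≰)))
    (≡.sym (≡.cong₂ ℕ._+_
      (ind-no (at? 0) (iso-take-short {d ∷ w} (s≤s (ℕ.≰⇒> ≰))))
      (≡.cong (λ n → length (filter (at? ∘ suc) (upTo n))) (ℕ.m≤n⇒m∸n≡0 (ℕ.<⇒≤ (ℕ.≰⇒> ≰))))))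

occurrences-short : ∀ τ w → length w < length τ → occurrences τ w ≡ 0
occurrences-short τ []      _  = refl
occurrences-short τ (c ∷ w) lt = ≡.cong₂ ℕ._+_
  (ind-no (orderIsomorphic? (take (length τ) (c ∷ w)) τ) (iso-take-short {c ∷ w} lt))
  (occurrences-short τ w (ℕ.<-trans (ℕ.n<1+n _) lt))

occurrences-map : ∀ {f} → StrictlyMonotone f → ∀ τ w → occurrences τ (map f w) ≡ occurrences τ w
occurrences-map         mono τ []      = refl
occurrences-map {f = f} mono τ (c ∷ w) = ≡.cong₂ ℕ._+_
  (ind-⇔ (orderIsomorphic? (take (length τ) (map f (c ∷ w))) τ) (orderIsomorphic? (take (length τ) (c ∷ w)) τ)
    (λ iso → iso-map⁻ mono (≡.subst (λ u → OrderIsomorphic u τ) (take-map (length τ) (c ∷ w)) iso))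
    (λ iso → ≡.subst (λ u → OrderIsomorphic u τ) (≡.sym (take-map (length τ) (c ∷ w))) (iso-map⁺ mono iso)))
  (occurrences-map mono τ w)

data HasSuffix (ρ : Word) : Word → Set where
  here  : ∀ {w} → OrderIsomorphic w ρ → HasSuffix ρ w
  there : ∀ {c w} → HasSuffix ρ w → HasSuffix ρ (c ∷ w)

hasSuffix? : ∀ ρ → Decidable (HasSuffix ρ)
hasSuffix? ρ [] = map′ here (λ { (here iso) → iso }) (orderIsomorphic? [] ρ)
hasSuffix? ρ (c ∷ w) = map′ [ here , there ]′ (λ { (here iso) → inj₁ iso ; (there s) → inj₂ s })
  (orderIsomorphic? (c ∷ w) ρ ⊎-dec hasSuffix? ρ w)

hasSuffix-length : ∀ {ρ w} → HasSuffix ρ w → length ρ ≤ length w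
hasSuffix-length (here iso) = ℕ.≤-reflexive (≡.sym (proj₁ iso))
hasSuffix-length (there s)  = ℕ.m≤n⇒m≤1+n (hasSuffix-length s)

hasSuffix-map⁺ : ∀ {ρ f w} → StrictlyMonotone f → HasSuffix ρ w → HasSuffix ρ (map f w)
hasSuffix-map⁺ mono (here iso) = here (iso-map⁺ mono iso)
hasSuffix-map⁺ mono (there s)  = there (hasSuffix-map⁺ mono s)

hasSuffix-map⁻ : ∀ {ρ f} w → StrictlyMonotone f → HasSuffix ρ (map f w) → HasSuffix ρ w
hasSuffix-map⁻ []      mono (here iso) = here iso
hasSuffix-map⁻ (c ∷ w) mono (here iso) = here (iso-map⁻ mono iso)
hasSuffix-map⁻ (c ∷ w) mono (there s)  = there (hasSuffix-map⁻ w mono s)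

hasSuffix-++⁺ : ∀ {ρ} u {v} → HasSuffix ρ v → HasSuffix ρ (u ++ v)
hasSuffix-++⁺ []      s = s
hasSuffix-++⁺ (_ ∷ u) s = there (hasSuffix-++⁺ u s)

initialRun-makeRoom : ∀ k w → initialRun (map (makeRoom k) w) ≡ initialRun w
initialRun-makeRoom k []                = refl
initialRun-makeRoom k (0 ∷ w)           = refl
initialRun-makeRoom k (1 ∷ w)           = ≡.cong suc (initialRun-makeRoom k w)
initialRun-makeRoom k (suc (suc c) ∷ w) = refl

initialRun-take⁺ : ∀ n w → n ≤ initialRun w → take n w ≡ replicate n 1
initialRun-take⁺ zero    w       _       = refl
initialRun-take⁺ (suc n) (1 ∷ w) (s≤s le) = ≡.cong (1 ∷_) (initialRun-take⁺ n w le)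

initialRun-take⁻ : ∀ n {w} → All (_≡ 1) (take n w) → length (take n w) ≤ initialRun w
initialRun-take⁻ zero            _           = z≤n
initialRun-take⁻ (suc n) {[]}    _           = z≤n
initialRun-take⁻ (suc n) {_ ∷ _} (refl ∷ ps) = s≤s (initialRun-take⁻ n ps)

take-++-≤ : ∀ n {u v : Word} → n ≤ length u → take n (u ++ v) ≡ take n u
take-++-≤ zero              _        = refl
take-++-≤ (suc n) {_ ∷ _}   (s≤s le) = ≡.cong (_ ∷_) (take-++-≤ n le)

take-++-+ : ∀ (u : Word) {v} n → take (length u ℕ.+ n) (u ++ v) ≡ u ++ take n v
take-++-+ []      n = refl
take-++-+ (c ∷ u) n = ≡.cong (c ∷_) (take-++-+ u n)

zip-replicate : ∀ n {c d : ℕ} {p} → p ∈ zip (replicate n c) (replicate n d) → p ≡ (c , d)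
zip-replicate (suc n) (here refl) = refl
zip-replicate (suc n) (there p)   = zip-replicate n p

∈-replicate⁻ : ∀ n {c d : ℕ} → c ∈ replicate n d → c ≡ d
∈-replicate⁻ (suc n) (here refl) = refl
∈-replicate⁻ (suc n) (there c∈)  = ∈-replicate⁻ n c∈

emptyOrOne-take : ∀ n {w} → EmptyOrOne w → EmptyOrOne (take n w)
emptyOrOne-take zero    _         = []
emptyOrOne-take (suc n) []        = []
emptyOrOne-take (suc n) (one∷ w)  = one∷ (take n w)

∈-take⁻ : ∀ n {w : Word} {c} → c ∈ take n w → c ∈ w
∈-take⁻ (suc n) {_ ∷ _} (here e)   = here e
∈-take⁻ (suc n) {_ ∷ _} (there c∈) = there (∈-take⁻ n c∈)

-- Occurrences of `(ρ + 1) 1^b` across a boundary.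

module Pattern (ρ : Word) (ρ-positive : ∀ {c} → c ∈ ρ → 1 ≤ c) (1≤ρ : 1 ≤ length ρ) (b′ : ℕ) where

  b : ℕ
  b = suc b′

  ones τ : Word
  ones = replicate b 1
  τ    = map suc ρ ++ ones

  length-τ : length τ ≡ length ρ ℕ.+ b
  length-τ = ≡.trans (length-++ (map suc ρ)) (≡.cong₂ ℕ._+_ (length-map suc ρ) (length-replicate b))

  ρ<τ : length ρ < length τ
  ρ<τ = ≡.subst (length ρ <_) (≡.sym length-τ) (ℕ.m<m+n (length ρ) (s≤s z≤n))

  1∈τ : 1 ∈ τ
  1∈τ = ∈-++⁺ʳ (map suc ρ) (here refl)

  τ-positive : ∀ {c} → c ∈ τ → 1 ≤ c
  τ-positive c∈ with ∈-++⁻ (map suc ρ) c∈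
  ... | inj₁ c∈ρ with _ , _ , refl ← ∈-map⁻ suc c∈ρ = s≤s z≤n
  τ-positive c∈ | inj₂ c∈1 = ℕ.≤-reflexive (≡.sym (∈-replicate⁻ b c∈1))

  map-suc-ρ-≥2 : ∀ {c} → c ∈ map suc ρ → 1 < c
  map-suc-ρ-≥2 c∈ with _ , d∈ , refl ← ∈-map⁻ suc c∈ = s≤s (ρ-positive d∈)

  -- The letter opposite a 1 of `τ` would have to be smaller than 1.
  one-against-ρ : ∀ {w y} → (∀ {c} → c ∈ w → 1 ≤ c) → OrderIsomorphic w τ → 1 < y → ¬ ((1 , y) ∈ zip w τ)
  one-against-ρ {w} positive iso 1<y p with x , x∈ , r ← zip-partnerʳ {w} {τ} (proj₁ iso) 1∈τ =
    ℕ.<⇒≱ (from (proj₁ (iso-sameOrder iso r p)) 1<y) (positive x∈)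

  -- A misaligned boundary sets either the 1 after `u` against a letter of `ρ + 1`, or a letter
  -- above 1 against a 1 of `τ`. Both are impossible, since 1 is the least letter of both words.
  iso-split⁻ : ∀ {u v} → All (1 <_) u → (∀ {c} → c ∈ v → 1 ≤ c) → OrderIsomorphic (u ++ 1 ∷ v) τ →
               OrderIsomorphic u ρ × All (_≡ 1) (1 ∷ v) × length (1 ∷ v) ≡ b
  iso-split⁻ {u} {v} 1<u v-positive iso with zip-++-trichotomy u (map suc ρ) {ones} (proj₁ iso)
  ... | inj₂ (inj₂ (y , y∈ , p)) = ⊥-elim (one-against-ρ positive iso (map-suc-ρ-≥2 y∈) p)
    where
    positive : ∀ {c} → c ∈ u ++ 1 ∷ v → 1 ≤ c
    positive c∈ with ∈-++⁻ u c∈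
    ... | inj₁ c∈u         = ℕ.<⇒≤ (All.lookup 1<u c∈u)
    ... | inj₂ (here refl) = s≤s z≤n
    ... | inj₂ (there c∈v) = v-positive c∈v
  ... | inj₂ (inj₁ (x , y , x∈ , y∈ , p)) with refl ← ∈-replicate⁻ b y∈
    with z , z∈ , r ← zip-partnerˡ {u ++ 1 ∷ v} {τ} (proj₁ iso) (∈-++⁺ʳ u (here refl)) =
    ⊥-elim (ℕ.<⇒≱ (to (proj₁ (iso-sameOrder iso r p)) (All.lookup 1<u x∈)) (τ-positive z∈))
  iso-split⁻ {u} {v} 1<u v-positive iso | inj₁ len =
      iso-sym (iso-map⁻ s≤s (iso-sym (iso-intro len λ p r → iso-sameOrder iso (zip-++ˡ {u} len p) (zip-++ˡ {u} len r))))
    , All.tabulate ≡1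
    , len′
    where
    len′ : length (1 ∷ v) ≡ b
    len′ = ≡.trans (ℕ.+-cancelˡ-≡ (length u) _ _ (begin
      length u ℕ.+ length (1 ∷ v)               ≡⟨ length-++ u ⟨
      length (u ++ 1 ∷ v)                       ≡⟨ proj₁ iso ⟩
      length τ                                  ≡⟨ length-++ (map suc ρ) ⟩
      length (map suc ρ) ℕ.+ length ones        ≡⟨ ≡.cong (ℕ._+ length ones) len ⟨
      length u ℕ.+ length ones                  ∎)) (length-replicate b)
      where open ≡.≡-Reasoning

    ≡1 : ∀ {c} → c ∈ 1 ∷ v → c ≡ 1
    ≡1 c∈ with y , y∈ , p ← zip-partnerˡ {1 ∷ v} {ones} (≡.trans len′ (≡.sym (length-replicate b))) c∈
      with refl ← ∈-replicate⁻ b y∈ =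
      from (proj₂ (iso-sameOrder iso (zip-++ʳ u (map suc ρ) len p) (zip-++ʳ u {1 ∷ v} (map suc ρ) {ones} len (here refl)))) refl

  iso-split⁺ : ∀ {u} → All (1 <_) u → OrderIsomorphic u ρ → OrderIsomorphic (u ++ ones) τ
  iso-split⁺ {u} 1<u iso = iso-intro (≡.trans (length-++ u) (≡.trans (≡.cong (ℕ._+ length ones) (proj₁ iso′)) (≡.sym (length-++ (map suc ρ)))))
    λ p∈ r∈ → same (zip-++⁻ u (map suc ρ) (proj₁ iso′) p∈) (zip-++⁻ u (map suc ρ) (proj₁ iso′) r∈)
    where
    iso′ : OrderIsomorphic u (map suc ρ)
    iso′ = iso-sym (iso-map⁺ s≤s (iso-sym iso))

    large : ∀ {x y} → (x , y) ∈ zip u (map suc ρ) → 1 < x × 1 < y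
    large p = All.lookup 1<u (zip-∈ˡ {u} {map suc ρ} p) , map-suc-ρ-≥2 (zip-∈ʳ {u} {map suc ρ} p)

    same : ∀ {p r} → p ∈ zip u (map suc ρ) ⊎ p ∈ zip ones ones → r ∈ zip u (map suc ρ) ⊎ r ∈ zip ones ones → SameOrder p r
    same (inj₁ p∈) (inj₁ r∈) = iso-sameOrder iso′ p∈ r∈
    same (inj₁ p∈) (inj₂ r∈) with refl ← zip-replicate b r∈ with 1<x , 1<y ← large p∈ =
        mk⇔ (λ x<1 → ⊥-elim (ℕ.<-asym x<1 1<x)) (λ y<1 → ⊥-elim (ℕ.<-asym y<1 1<y))
      , mk⇔ (λ x≡1 → ⊥-elim (ℕ.<⇒≢ 1<x (≡.sym x≡1))) (λ y≡1 → ⊥-elim (ℕ.<⇒≢ 1<y (≡.sym y≡1)))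
    same (inj₂ p∈) (inj₁ r∈) with refl ← zip-replicate b p∈ with 1<x , 1<y ← large r∈ =
        mk⇔ (λ _ → 1<y) (λ _ → 1<x)
      , mk⇔ (λ 1≡x → ⊥-elim (ℕ.<⇒≢ 1<x 1≡x)) (λ 1≡y → ⊥-elim (ℕ.<⇒≢ 1<y 1≡y))
    same (inj₂ p∈) (inj₂ r∈) with refl ← zip-replicate b p∈ | refl ← zip-replicate b r∈ =
      mk⇔ id id , mk⇔ id id

  -- The window contains all of `u` and a nonempty prefix of `v`, which therefore starts with 1, so
  -- the boundary is located by `iso-split⁻`.
  straddling⁻ : ∀ {u v} → length u < length τ → All (1 <_) u → EmptyOrOne v → (∀ {c} → c ∈ v → 1 ≤ c) →
    OrderIsomorphic (take (length τ) (u ++ v)) τ → OrderIsomorphic u ρ × b ≤ initialRun v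
  straddling⁻ {u} {v} u<τ 1<u head positive iso with n , eq ← ℕ.m≤n⇒∃[o]m+o≡n (ℕ.<⇒≤ u<τ) =
    go (emptyOrOne-take n head) refl (≡.subst (λ w → OrderIsomorphic w τ) take≡ iso)
    where
    take≡ : take (length τ) (u ++ v) ≡ u ++ take n v
    take≡ = ≡.trans (≡.cong (λ k → take k (u ++ v)) (≡.sym eq)) (take-++-+ u n)

    go : ∀ {w} → EmptyOrOne w → take n v ≡ w → OrderIsomorphic (u ++ w) τ → OrderIsomorphic u ρ × b ≤ initialRun v
    go [] _ iso = ⊥-elim (ℕ.<⇒≢ u<τ (≡.trans (≡.cong length (≡.sym (++-identityʳ u))) (proj₁ iso)))
    go (one∷ w) take≡ iso
      with iso′ , ≡1 , len ← iso-split⁻ 1<u (λ c∈ → positive (∈-take⁻ n (≡.subst (_ ∈_) (≡.sym take≡) (there c∈)))) iso =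
      iso′ , ≡.subst (_≤ initialRun v) (≡.trans (≡.cong length take≡) len)
               (initialRun-take⁻ n (≡.subst (All (_≡ 1)) (≡.sym take≡) ≡1))

  straddling⁺ : ∀ {u v} → All (1 <_) u → OrderIsomorphic u ρ → b ≤ initialRun v →
    OrderIsomorphic (take (length τ) (u ++ v)) τ
  straddling⁺ {u} {v} 1<u iso b≤ = ≡.subst (λ w → OrderIsomorphic w τ) (≡.sym take≡) (iso-split⁺ 1<u iso)
    where
    take≡ : take (length τ) (u ++ v) ≡ u ++ ones
    take≡ = begin
      take (length τ) (u ++ v)            ≡⟨ ≡.cong (λ k → take k (u ++ v)) length-τ ⟩
      take (length ρ ℕ.+ b) (u ++ v)      ≡⟨ ≡.cong (λ k → take (k ℕ.+ b) (u ++ v)) (proj₁ iso) ⟨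
      take (length u ℕ.+ b) (u ++ v)      ≡⟨ take-++-+ u b ⟩
      u ++ take b v                       ≡⟨ ≡.cong (u ++_) (initialRun-take⁺ b v b≤) ⟩
      u ++ ones                           ∎
      where open ≡.≡-Reasoning

  -- Induction on `u`, moving the start of the window to the left one letter at a time: the
  -- indicator becomes 1 exactly at the window that begins with a copy of `ρ` ending at the
  -- boundary.
  occurrences-++ : ∀ {u v} → All (1 <_) u → EmptyOrOne v → (∀ {c} → c ∈ v → 1 ≤ c) →
    occurrences τ (u ++ v) ≡
    occurrences τ u ℕ.+ occurrences τ v ℕ.+ ind (hasSuffix? ρ u ×-dec (b ℕ.≤? initialRun v))
  occurrences-++ {[]} {v} _ head positive = ≡.sym (≡.trans
    (≡.cong (occurrences τ v ℕ.+_) (ind-no (hasSuffix? ρ [] ×-dec (b ℕ.≤? initialRun v))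
      λ (s , _) → ℕ.<⇒≱ 1≤ρ (hasSuffix-length s)))
    (ℕ.+-identityʳ _))
  occurrences-++ {c ∷ u} {v} (1<c ∷ 1<u) head positive = begin
    straddle ℕ.+ occurrences τ (u ++ v)                         ≡⟨ ≡.cong (straddle ℕ.+_) (occurrences-++ 1<u head positive) ⟩
    straddle ℕ.+ (occurrences τ u ℕ.+ occurrences τ v ℕ.+ before)  ≡⟨ rearrange straddle (occurrences τ u) (occurrences τ v) before ⟩
    straddle ℕ.+ before ℕ.+ (occurrences τ u ℕ.+ occurrences τ v)  ≡⟨ ≡.cong (ℕ._+ (occurrences τ u ℕ.+ occurrences τ v)) (key (suc (length u) ℕ.<? length τ)) ⟩
    inside ℕ.+ after ℕ.+ (occurrences τ u ℕ.+ occurrences τ v)    ≡⟨ rearrange′ inside after (occurrences τ u) (occurrences τ v) ⟩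
    inside ℕ.+ occurrences τ u ℕ.+ occurrences τ v ℕ.+ after      ∎
    where
    open ≡.≡-Reasoning
    open +-*-Solver using (solve; _:+_; _:=_)
    straddle? = orderIsomorphic? (take (length τ) (c ∷ u ++ v)) τ
    inside?   = orderIsomorphic? (take (length τ) (c ∷ u)) τ
    run?      = b ℕ.≤? initialRun v
    straddle  = ind straddle?
    inside    = ind inside?
    before       = ind (hasSuffix? ρ u ×-dec run?)
    after       = ind (hasSuffix? ρ (c ∷ u) ×-dec run?)

    rearrange : ∀ s x y o → s ℕ.+ (x ℕ.+ y ℕ.+ o) ≡ s ℕ.+ o ℕ.+ (x ℕ.+ y)
    rearrange = solve 4 (λ s x y o → s :+ (x :+ y :+ o) := s :+ o :+ (x :+ y)) refl

    rearrange′ : ∀ i n x y → i ℕ.+ n ℕ.+ (x ℕ.+ y) ≡ i ℕ.+ x ℕ.+ y ℕ.+ n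
    rearrange′ = solve 4 (λ i n x y → i :+ n :+ (x :+ y) := i :+ x :+ y :+ n) refl

    before≡after : ¬ OrderIsomorphic (c ∷ u) ρ → before ≡ after
    before≡after ¬iso = ind-⇔ (hasSuffix? ρ u ×-dec run?) (hasSuffix? ρ (c ∷ u) ×-dec run?)
      (λ (s , r) → there s , r)
      λ { (here iso , r) → ⊥-elim (¬iso iso) ; (there s , r) → s , r }

    -- If the window fits into `c ∷ u`, that word is longer than `ρ`, so no matching suffix begins
    -- at `c`. Otherwise the window reaches the boundary, and it matches only if `c ∷ u` is itself
    -- the copy of `ρ`.
    key : Dec (suc (length u) < length τ) → straddle ℕ.+ before ≡ inside ℕ.+ after
    key (no  ≮τ) = ≡.cong₂ ℕ._+_
      (ind-⇔ straddle? inside? (≡.subst (λ w → OrderIsomorphic w τ) take≡) (≡.subst (λ w → OrderIsomorphic w τ) (≡.sym take≡)))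
      (before≡after λ iso → ≮τ (≡.subst (_< length τ) (≡.sym (proj₁ iso)) ρ<τ))
      where
      take≡ : take (length τ) (c ∷ u ++ v) ≡ take (length τ) (c ∷ u)
      take≡ = take-++-≤ (length τ) {c ∷ u} (ℕ.≮⇒≥ ≮τ)
    key (yes <τ) = ≡.trans (short (orderIsomorphic? (c ∷ u) ρ))
      (≡.cong (ℕ._+ after) (≡.sym (ind-no inside? (iso-take-short {c ∷ u} <τ))))
      where
      short : Dec (OrderIsomorphic (c ∷ u) ρ) → straddle ℕ.+ before ≡ after
      short (no ¬iso) = ≡.cong₂ ℕ._+_
        (ind-no straddle? λ s → ¬iso (proj₁ (straddling⁻ {c ∷ u} <τ (1<c ∷ 1<u) head positive s))) (before≡after ¬iso)
      -- Now `u` is shorter than `ρ`, so it has no suffix that matches, and nothing is counted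
      -- twice.
      short (yes iso) = ≡.trans (≡.cong (straddle ℕ.+_) (ind-no (hasSuffix? ρ u ×-dec run?)
          λ (s , _) → ℕ.<⇒≱ (ℕ.≤-reflexive (proj₁ iso)) (hasSuffix-length s)))
        (≡.trans (ℕ.+-identityʳ straddle)
          (ind-⇔ straddle? (hasSuffix? ρ (c ∷ u) ×-dec run?)
            (λ s → here iso , proj₂ (straddling⁻ {c ∷ u} <τ (1<c ∷ 1<u) head positive s))
            (λ (_ , r) → straddling⁺ {c ∷ u} (1<c ∷ 1<u) iso r)))

-- Grafting the pattern

encode-map-suc-≥2 : ∀ t → All (1 <_) (map suc (encode t))
encode-map-suc-≥2 t = All.map⁺ (All.tabulate (s≤s ∘ encode-positive t))

makeRoom-encode-positive : ∀ k t {c} → c ∈ map (makeRoom k) (encode t) → 1 ≤ c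
makeRoom-encode-positive k t c∈ with ∈-map⁻ (makeRoom k) c∈
... | 0           , d∈ , refl = encode-positive t d∈
... | 1           , _  , refl = s≤s z≤n
... | suc (suc _) , _  , refl = s≤s z≤n

run : Tree → ℕ
run t = initialRun (encode t)

run-leaf-node : ∀ r → run (node leaf r) ≡ suc (run r)
run-leaf-node r = ≡.cong suc (initialRun-makeRoom 0 (encode r))

node-injective : ∀ {l l′ r r′} → node l r ≡ node l′ r′ → l ≡ l′ × r ≡ r′
node-injective refl = refl , refl

-- As `makeRoom 0` is the identity, `node leaf t` is the word of `t` with a 1 prepended.
leftGraft : ℕ → Tree → Tree
leftGraft zero    t = t
leftGraft (suc n) t = node leaf (leftGraft n t)

leftGraft-injective : ∀ n {s t} → leftGraft n s ≡ leftGraft n t → s ≡ t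
leftGraft-injective zero    eq = eq
leftGraft-injective (suc n) eq = leftGraft-injective n (proj₂ (node-injective eq))

size-leftGraft : ∀ n t → size (leftGraft n t) ≡ n ℕ.+ size t
size-leftGraft zero    t = refl
size-leftGraft (suc n) t = ≡.cong suc (size-leftGraft n t)

run-leftGraft : ∀ n {t} → IsNode t → suc n ≤ run (leftGraft n t)
run-leftGraft zero    isNode = s≤s z≤n
run-leftGraft (suc n) {t} nt = ≡.subst (suc (suc n) ≤_) (≡.sym (run-leaf-node (leftGraft n t))) (s≤s (run-leftGraft n nt))

leftGraft-onto : ∀ n t → suc n ≤ run t → ∃[ s ] IsNode s × t ≡ leftGraft n s
leftGraft-onto zero    (node l r)    _  = node l r , isNode , refl
leftGraft-onto (suc n) (node leaf r) le
  with s , s-node , refl ← leftGraft-onto n r (ℕ.≤-pred (≡.subst (suc (suc n) ≤_) (run-leaf-node r) le)) = s , s-node , refl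
leftGraft-onto (suc n) (node (node _ _) r) (s≤s ())

module Grafts (σl σr : Tree) (b′ : ℕ) (run-σ : 1 ≤ b′ → run (node σl σr) ≡ 1) where

  σ : Tree
  σ = node σl σr

  ρ : Word
  ρ = encode σ

  open Pattern ρ (encode-positive σ) (s≤s z≤n) b′ public

  statistic : Tree → ℕ
  statistic t = occurrences τ (encode t)

  EndsWithρ StartsWithOnes : Tree → Set
  EndsWithρ t = HasSuffix ρ (encode t)
  StartsWithOnes t = b ≤ run t

  endsWithρ? : ∀ t → Dec (EndsWithρ t)
  endsWithρ? t = hasSuffix? ρ (encode t)

  startsWithOnes? : ∀ t → Dec (StartsWithOnes t)
  startsWithOnes? t = b ℕ.≤? run t

  ¬endsWithρ-leaf : ¬ EndsWithρ leaf
  ¬endsWithρ-leaf s with () ← hasSuffix-length s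

  -- The smallest letter of τ is 1, but its first letter is not, so τ does not occur at the very beginning.
  statistic-node : ∀ l r → statistic (node l r) ≡ statistic l ℕ.+ statistic r ℕ.+ ind (endsWithρ? l ×-dec startsWithOnes? r)
  statistic-node l r = begin
    occurrences τ (1 ∷ L ++ R)                                                              ≡⟨ ≡.cong (ℕ._+ occurrences τ (L ++ R)) (ind-no first? ¬first) ⟩
    occurrences τ (L ++ R)                                                                  ≡⟨ occurrences-++ (encode-map-suc-≥2 l) (makeRoom-encode-head k r) (makeRoom-encode-positive k r) ⟩
    occurrences τ L ℕ.+ occurrences τ R ℕ.+ ind (hasSuffix? ρ L ×-dec (b ℕ.≤? initialRun R))
      ≡⟨ ≡.cong₂ ℕ._+_ (≡.cong₂ ℕ._+_ (occurrences-map s≤s τ (encode l)) (occurrences-map mono τ (encode r)))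
           (ind-⇔ (hasSuffix? ρ L ×-dec (b ℕ.≤? initialRun R)) (endsWithρ? l ×-dec startsWithOnes? r)
             (λ (s , le) → hasSuffix-map⁻ (encode l) s≤s s , ≡.subst (b ≤_) (initialRun-makeRoom k (encode r)) le)
             (λ (s , le) → hasSuffix-map⁺ s≤s s , ≡.subst (b ≤_) (≡.sym (initialRun-makeRoom k (encode r))) le)) ⟩
    statistic l ℕ.+ statistic r ℕ.+ ind (endsWithρ? l ×-dec startsWithOnes? r) ∎
    where
    open ≡.≡-Reasoning
    k = blocks l
    L = map suc (encode l)
    R = map (makeRoom k) (encode r)
    first? = orderIsomorphic? (take (length τ) (1 ∷ L ++ R)) τ

    mono : StrictlyMonotone (makeRoom k)
    mono {c} {d} = makeRoom-mono k {c} {d}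

    positive : ∀ {c} → c ∈ encode (node l r) → 1 ≤ c
    positive = encode-positive (node l r)

    ¬first : ¬ OrderIsomorphic _ τ
    ¬first iso = one-against-ρ (positive ∘ ∈-take⁻ (length τ) {encode (node l r)}) iso (s≤s (s≤s z≤n)) (here refl)

  -- The last letter of a word lies in the right subtree if that is nonempty, and otherwise in the
  -- left one. The path to it ends at the one-letter tree, whose place `σ` takes. Sending the leaf
  -- to itself keeps the map injective on all trees.
  ρGraft : Tree → Tree
  ρGraft leaf                    = leaf
  ρGraft (node l (node r₁ r₂))   = node l (ρGraft (node r₁ r₂))
  ρGraft (node leaf leaf)        = σ
  ρGraft (node (node l₁ l₂) leaf) = node (ρGraft (node l₁ l₂)) leaf

  size-ρGraft : ∀ {t} → IsNode t → size (ρGraft t) ≡ size σl ℕ.+ size σr ℕ.+ size t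
  size-ρGraft {node l (node r₁ r₂)} _ = begin
    suc (size l ℕ.+ size (ρGraft (node r₁ r₂)))              ≡⟨ ≡.cong (λ n → suc (size l ℕ.+ n)) (size-ρGraft {node r₁ r₂} isNode) ⟩
    suc (size l ℕ.+ (a ℕ.+ size (node r₁ r₂)))               ≡⟨ solve 3 (λ l a r → con 1 :+ (l :+ (a :+ r)) := a :+ (con 1 :+ (l :+ r))) refl (size l) a (size (node r₁ r₂)) ⟩
    a ℕ.+ suc (size l ℕ.+ size (node r₁ r₂))                 ∎
    where
    open ≡.≡-Reasoning
    open +-*-Solver using (solve; _:+_; _:=_; con)
    a = size σl ℕ.+ size σr
  size-ρGraft {node leaf leaf} _ = ℕ.+-comm 1 (size σl ℕ.+ size σr)
  size-ρGraft {node (node l₁ l₂) leaf} _ = begin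
    suc (size (ρGraft (node l₁ l₂)) ℕ.+ 0)         ≡⟨ ≡.cong (λ n → suc (n ℕ.+ 0)) (size-ρGraft {node l₁ l₂} isNode) ⟩
    suc (a ℕ.+ size (node l₁ l₂) ℕ.+ 0)            ≡⟨ solve 2 (λ a l → con 1 :+ (a :+ l :+ con 0) := a :+ (con 1 :+ (l :+ con 0))) refl a (size (node l₁ l₂)) ⟩
    a ℕ.+ suc (size (node l₁ l₂) ℕ.+ 0)            ∎
    where
    open ≡.≡-Reasoning
    open +-*-Solver using (solve; _:+_; _:=_; con)
    a = size σl ℕ.+ size σr

  isNode-ρGraft : ∀ {t} → IsNode t → IsNode (ρGraft t)
  isNode-ρGraft {node l (node _ _)}      _ = isNode
  isNode-ρGraft {node leaf leaf}         _ = isNode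
  isNode-ρGraft {node (node _ _) leaf}   _ = isNode

  ρGraft≢leaf : ∀ {l r} → ρGraft (node l r) ≢ leaf
  ρGraft≢leaf {l} {r} eq with () ← ≡.subst IsNode eq (isNode-ρGraft (isNode {l} {r}))

  -- The one-letter tree is grafted to `σ`, and a larger tree has a larger graft.
  size≤⇒ρGraft≢σ : ∀ {t} → 1 < size t → σ ≢ ρGraft t
  size≤⇒ρGraft≢σ {t@(node _ _)} 1<t eq = ℕ.<⇒≢ (ℕ.+-monoʳ-< a 1<t)
    (≡.trans (≡.trans (ℕ.+-comm a 1) (≡.cong size eq)) (size-ρGraft {t} isNode))
    where a = size σl ℕ.+ size σr

  ρGraft-injective : ∀ {s t} → ρGraft s ≡ ρGraft t → s ≡ t
  ρGraft-injective {leaf} {leaf} _ = refl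
  ρGraft-injective {leaf} {node l r} eq = ⊥-elim (ρGraft≢leaf {l} {r} (≡.sym eq))
  ρGraft-injective {node l r} {leaf} eq = ⊥-elim (ρGraft≢leaf {l} {r} eq)
  ρGraft-injective {node l (node r₁ r₂)} {node l′ (node r₁′ r₂′)} eq =
    ≡.cong₂ node (proj₁ (node-injective eq)) (ρGraft-injective (proj₂ (node-injective eq)))
  ρGraft-injective {node l (node r₁ r₂)} {node leaf leaf} eq =
    ⊥-elim (size≤⇒ρGraft≢σ {node l (node r₁ r₂)} (s≤s (ℕ.≤-trans (s≤s z≤n) (ℕ.m≤n+m _ (size l)))) (≡.sym eq))
  ρGraft-injective {node l (node r₁ r₂)} {node (node _ _) leaf} eq = ⊥-elim (ρGraft≢leaf {r₁} {r₂} (proj₂ (node-injective eq)))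
  ρGraft-injective {node leaf leaf} {node l (node r₁ r₂)} eq =
    ⊥-elim (size≤⇒ρGraft≢σ {node l (node r₁ r₂)} (s≤s (ℕ.≤-trans (s≤s z≤n) (ℕ.m≤n+m _ (size l)))) eq)
  ρGraft-injective {node leaf leaf} {node leaf leaf} _ = refl
  ρGraft-injective {node leaf leaf} {node (node l₁ l₂) leaf} eq = ⊥-elim (size≤⇒ρGraft≢σ {node (node l₁ l₂) leaf} (s≤s (s≤s z≤n)) eq)
  ρGraft-injective {node (node _ _) leaf} {node l (node r₁ r₂)} eq = ⊥-elim (ρGraft≢leaf {r₁} {r₂} (≡.sym (proj₂ (node-injective eq))))
  ρGraft-injective {node (node l₁ l₂) leaf} {node leaf leaf} eq = ⊥-elim (size≤⇒ρGraft≢σ {node (node l₁ l₂) leaf} (s≤s (s≤s z≤n)) (≡.sym eq))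
  ρGraft-injective {node (node l₁ l₂) leaf} {node (node l₁′ l₂′) leaf} eq =
    ≡.cong (λ l → node l leaf) (ρGraft-injective (proj₁ (node-injective eq)))

  -- The replaced letter belongs to the initial run only if the word consists of ones. Its last 1
  -- then gives way to a copy of `ρ`, whose own run has length 1 by assumption.
  run-ρGraft : run σ ≡ 1 → ∀ t → run (ρGraft t) ≡ run t
  run-ρGraft _  leaf                       = refl
  run-ρGraft h  (node leaf r@(node _ _))   = ≡.trans (run-leaf-node (ρGraft r)) (≡.trans (≡.cong suc (run-ρGraft h r)) (≡.sym (run-leaf-node r)))
  run-ρGraft _  (node (node _ _) (node _ _)) = refl
  run-ρGraft h  (node leaf leaf)           = h
  run-ρGraft _  (node (node l₁ l₂) leaf) with ρGraft (node l₁ l₂) | isNode-ρGraft (isNode {l₁} {l₂})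
  ... | _ | isNode = refl

  positive-run : ∀ {t} → IsNode t → 1 ≤ run t
  positive-run isNode = s≤s z≤n

  -- For `b = 1` the condition says only that the tree is a node. For larger `b` the length of the
  -- initial run matters, and this is where the restriction on `ρ` enters.
  startsWithOnes-ρGraft : ∀ {t} → IsNode t →
    (StartsWithOnes (ρGraft t) → StartsWithOnes t) × (StartsWithOnes t → StartsWithOnes (ρGraft t))
  startsWithOnes-ρGraft {t} nt = go b′ run-σ
    where
    go : ∀ n → (1 ≤ n → run σ ≡ 1) → (suc n ≤ run (ρGraft t) → suc n ≤ run t) × (suc n ≤ run t → suc n ≤ run (ρGraft t))
    go zero    _ = (λ _ → positive-run nt) , (λ _ → positive-run (isNode-ρGraft nt))
    go (suc n) h = ≡.subst (suc (suc n) ≤_) eq , ≡.subst (suc (suc n) ≤_) (≡.sym eq)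
      where eq = run-ρGraft (h (s≤s z≤n)) t

  statistic-leaf-leaf : statistic (node leaf leaf) ≡ 0
  statistic-leaf-leaf = occurrences-short τ (1 ∷ []) (ℕ.≤-<-trans (s≤s z≤n) ρ<τ)

  -- A graft in the right subtree leaves the left one alone and does not affect whether the right
  -- one starts with `b` ones. A graft in the left subtree happens only when the right one is empty,
  -- and then nothing straddles.
  statistic-ρGraft : ∀ {t} → IsNode t → statistic (ρGraft t) ≡ statistic t
  statistic-ρGraft {node l r@(node _ _)} _ = begin
    statistic (node l (ρGraft r))                                                                  ≡⟨ statistic-node l (ρGraft r) ⟩
    statistic l ℕ.+ statistic (ρGraft r) ℕ.+ ind (endsWithρ? l ×-dec startsWithOnes? (ρGraft r))
      ≡⟨ ≡.cong₂ ℕ._+_ (≡.cong (statistic l ℕ.+_) (statistic-ρGraft {r} isNode))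
           (ind-⇔ (endsWithρ? l ×-dec startsWithOnes? (ρGraft r)) (endsWithρ? l ×-dec startsWithOnes? r)
             (λ (e , s) → e , proj₁ (startsWithOnes-ρGraft {r} isNode) s) (λ (e , s) → e , proj₂ (startsWithOnes-ρGraft {r} isNode) s)) ⟩
    statistic l ℕ.+ statistic r ℕ.+ ind (endsWithρ? l ×-dec startsWithOnes? r)                     ≡⟨ statistic-node l r ⟨
    statistic (node l r)                                                                           ∎
    where open ≡.≡-Reasoning
  -- Both words are shorter than `τ`.
  statistic-ρGraft {node leaf leaf} _ = ≡.trans (occurrences-short τ ρ ρ<τ) (≡.sym statistic-leaf-leaf)
  statistic-ρGraft {node l@(node _ _) leaf} _ = begin
    statistic (node (ρGraft l) leaf)                                                               ≡⟨ statistic-node (ρGraft l) leaf ⟩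
    statistic (ρGraft l) ℕ.+ 0 ℕ.+ ind (endsWithρ? (ρGraft l) ×-dec startsWithOnes? leaf)
      ≡⟨ ≡.cong₂ ℕ._+_ (≡.cong (ℕ._+ 0) (statistic-ρGraft {l} isNode))
           (≡.trans (ind-no (endsWithρ? (ρGraft l) ×-dec startsWithOnes? leaf) (λ ()))
                    (≡.sym (ind-no (endsWithρ? l ×-dec startsWithOnes? leaf) λ ()))) ⟩
    statistic l ℕ.+ 0 ℕ.+ ind (endsWithρ? l ×-dec startsWithOnes? leaf)                            ≡⟨ statistic-node l leaf ⟨
    statistic (node l leaf)                                                                        ∎
    where open ≡.≡-Reasoning

  endsWithρ-ρGraft : ∀ {t} → IsNode t → EndsWithρ (ρGraft t)
  endsWithρ-ρGraft {node l (node r₁ r₂)} _ = there (hasSuffix-++⁺ (map suc (encode l))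
    (hasSuffix-map⁺ (λ {c} {d} → makeRoom-mono (blocks l) {c} {d}) (endsWithρ-ρGraft {node r₁ r₂} isNode)))
  endsWithρ-ρGraft {node leaf leaf} _ = here (iso-refl ρ)
  endsWithρ-ρGraft {node (node l₁ l₂) leaf} _ = there (≡.subst (HasSuffix ρ) (≡.sym (++-identityʳ _))
    (hasSuffix-map⁺ s≤s (endsWithρ-ρGraft {node l₁ l₂} isNode)))

  -- ρ starts with its smallest letter, so a suffix isomorphic to ρ cannot start before a smaller letter.
  hasSuffix-++⁻ : ∀ {u v} → All (1 <_) u → HasSuffix ρ (u ++ 1 ∷ v) → HasSuffix ρ (1 ∷ v)
  hasSuffix-++⁻ []          s         = s
  hasSuffix-++⁻ (_ ∷ 1<u)   (there s) = hasSuffix-++⁻ 1<u s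
  hasSuffix-++⁻ {c ∷ u} {v} (1<c ∷ _) (here iso)
    with y , y∈ , p ← zip-partnerˡ {c ∷ u ++ 1 ∷ v} {ρ} (proj₁ iso) (there (∈-++⁺ʳ u (here refl))) =
    ⊥-elim (ℕ.<⇒≱ (to (proj₁ (iso-sameOrder iso p (here refl))) 1<c) (encode-positive σ y∈))

  ρGraft-onto : ∀ t → EndsWithρ t → ∃[ s ] IsNode s × t ≡ ρGraft s
  ρGraft-onto leaf s = ⊥-elim (¬endsWithρ-leaf s)
  -- The whole word is a copy of `ρ`, and order-isomorphic encodings are equal.
  ρGraft-onto (node l r) (here iso) = node leaf leaf , isNode , iso-encode {node l r} {σ} iso
  ρGraft-onto (node l leaf) (there s)
    with t@(node _ _) , isNode , refl ← ρGraft-onto l (hasSuffix-map⁻ (encode l) s≤s (≡.subst (HasSuffix ρ) (++-identityʳ _) s)) =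
    node t leaf , isNode , refl
  -- The suffix cannot start inside `α + 1`, as it would then contain the smaller 1 that opens `β`;
  -- so it lies within the right part.
  ρGraft-onto (node l r@(node _ _)) (there s)
    with t@(node _ _) , isNode , eq ← ρGraft-onto r (hasSuffix-map⁻ (encode r) (λ {c} {d} → makeRoom-mono (blocks l) {c} {d})
           (hasSuffix-++⁻ (encode-map-suc-≥2 l) s)) =
    node l t , isNode , ≡.cong (node l) eq

  ρGrafting : Grafting EndsWithρ statistic (size σl ℕ.+ size σr)
  ρGrafting = record
    { graft      = ρGraft
    ; injective  = ρGraft-injective
    ; size-graft = size-ρGraft
    ; preserves  = statistic-ρGraft
    ; onto       = λ {t} → ρGraft-onto t
    ; into       = endsWithρ-ρGraft
    }

  -- Nothing straddles a prepended 1: the left subtree is empty and cannot end with `ρ`.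
  statistic-leftGraft : ∀ n t → statistic (leftGraft n t) ≡ statistic t
  statistic-leftGraft zero    t = refl
  statistic-leftGraft (suc n) t = begin
    statistic (node leaf (leftGraft n t))     ≡⟨ statistic-node leaf (leftGraft n t) ⟩
    statistic (leftGraft n t) ℕ.+ ind (endsWithρ? leaf ×-dec startsWithOnes? (leftGraft n t))
      ≡⟨ ≡.cong (statistic (leftGraft n t) ℕ.+_) (ind-no (endsWithρ? leaf ×-dec startsWithOnes? (leftGraft n t)) (¬endsWithρ-leaf ∘ proj₁)) ⟩
    statistic (leftGraft n t) ℕ.+ 0           ≡⟨ ℕ.+-identityʳ _ ⟩
    statistic (leftGraft n t)                 ≡⟨ statistic-leftGraft n t ⟩
    statistic t                               ∎
    where open ≡.≡-Reasoning

  onesGrafting : Grafting StartsWithOnes statistic b′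
  onesGrafting = record
    { graft      = leftGraft b′
    ; injective  = leftGraft-injective b′
    ; size-graft = λ {t} _ → size-leftGraft b′ t
    ; preserves  = λ {t} _ → statistic-leftGraft b′ t
    ; onto       = λ {t} → leftGraft-onto b′ t
    ; into       = run-leftGraft b′
    }

-- The generating function

-- The coefficient of `x` shows that the denominator is nonzero: it is `2 (1 + u)`, that is `2q`,
-- when the exponent `a + b - 2` is 0, and 2 otherwise.
module LinearCoefficient {c ℓ} (K : CommutativeRing c ℓ) (u : CommutativeRing.Carrier K) where
  open CommutativeRing K renaming (refl to ≈-refl; sym to ≈-sym; trans to ≈-trans)
  open PowerSeries K using (seriesRing; X) renaming (const to constᴷ)
  open SeriesShift K using (const-*ˢ; X-*ˢ-zero)
  private module S = CommutativeRing seriesRing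
  open import Algebra.Properties.Semiring.Exp S.semiring using (_^_)
  open import Algebra.Properties.Semiring.Mult S.semiring renaming (_×_ to _·_) using ()
  open import Algebra.Properties.Semiring.Mult semiring renaming (_×_ to _·ᴷ_) using (×-congʳ)
  open import Algebra.Solver.Ring.NaturalCoefficients.Default commutativeSemiring
    using (solve; _:+_; _:*_; _:=_; con)

  denominatorᴷ : ℕ → ℕ → Carrier
  denominatorᴷ n = 2 · X S.* (S.1# S.+ constᴷ u S.* X ^ n)

  denominator-1 : ∀ n {e} → (constᴷ u S.* X ^ n) 0 ≈ e → denominatorᴷ n 1 ≈ 2 ·ᴷ (1# + e)
  denominator-1 n eq = ≈-trans
    (solve 2 (λ e₀ e₁ → (con 0 :+ (con 0 :+ con 0)) :* e₁ :+ ((con 1 :+ (con 1 :+ con 0)) :* e₀ :+ con 0)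
                        := e₀ :+ (e₀ :+ con 0)) ≈-refl (E 0) (E 1))
    (×-congʳ 2 (+-congˡ eq))
    where E = S.1# S.+ constᴷ u S.* X ^ n

  denominator-1-zero : denominatorᴷ 0 1 ≈ 2 ·ᴷ (1# + u)
  denominator-1-zero = denominator-1 0 (≈-trans (const-*ˢ u S.1# 0) (*-identityʳ u))

  denominator-1-suc : ∀ n → denominatorᴷ (suc n) 1 ≈ 2 ·ᴷ (1# + 0#)
  denominator-1-suc n = denominator-1 (suc n)
    (≈-trans (const-*ˢ u (X ^ suc n) 0) (≈-trans (*-congˡ (X-*ˢ-zero (X ^ n))) (zeroʳ u)))

  numerator-0 : ∀ F m n → 1 ≤ m →
    (S.1# S.+ 2 · constᴷ u S.* X ^ m S.- 2 · X S.* (S.1# S.+ constᴷ u S.* X ^ n) S.* F) 0 ≈ 1#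
  numerator-0 F (suc m) n _ = begin
    1# + ((2 · constᴷ u) 0 * (X ^ suc m) 0 + 0#) - (((2 · X) 0 * E 0 + 0#) * F 0 + 0#)
      ≈⟨ +-cong (+-congˡ (≈-trans (+-identityʳ _) (≈-trans (*-congˡ (X-*ˢ-zero (X ^ m))) (zeroʳ _))))
           (-‿cong (solve 2 (λ e f → ((con 0 :+ (con 0 :+ con 0)) :* e :+ con 0) :* f :+ con 0 := con 0) ≈-refl (E 0) (F 0))) ⟩
    1# + 0# - 0#    ≈⟨ +-assoc _ _ _ ⟩
    1# + (0# - 0#)  ≈⟨ +-congˡ (-‿inverseʳ 0#) ⟩
    1# + 0#         ≈⟨ +-identityʳ 1# ⟩
    1#              ∎
    where
    open import Relation.Binary.Reasoning.Setoid setoid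
    E = S.1# S.+ constᴷ u S.* X ^ n

module Solution {c ℓ} (K : CommutativeRing c ℓ) (q : CommutativeRing.Carrier K)
  (σl σr : Tree) (b′ : ℕ) (run-σ : 1 ≤ b′ → run (node σl σr) ≡ 1) where

  open CommutativeRing K renaming (refl to ≈-refl; sym to ≈-sym; trans to ≈-trans)
  open PowerSeries K using (seriesRing; X) renaming (Series to Seriesᴷ; const to constᴷ; IsSqrt to IsSqrtᴷ; IsQuotient to IsQuotientᴷ)
  open Grafts σl σr b′ run-σ
  open ListSum K
  private
    module S = CommutativeRing seriesRing
    module T = TreeSeries K q statistic EndsWithρ StartsWithOnes endsWithρ? startsWithOnes?
                 refl statistic-node (size σl ℕ.+ size σr) b′ ρGrafting onesGrafting
    u = constᴷ (q - 1#)
    a = suc (size σl ℕ.+ size σr)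
  open LinearCoefficient K (q - 1#)
  open import Algebra.Properties.Semiring.Exp semiring using (^-congʳ) renaming (_^_ to _^ᴷ_)
  open import Algebra.Properties.Semiring.Exp S.semiring using (_^_)
  open import Algebra.Properties.Semiring.Mult S.semiring renaming (_×_ to _·_) using ()
  open import Algebra.Properties.Semiring.Mult semiring renaming (_×_ to _·ᴷ_) using ()

  Σ-NC≈F : ∀ n → Σ (λ π → q ^ᴷ μ τ π) (NC n) ≈ T.F n
  Σ-NC≈F n = begin
    Σ (λ π → q ^ᴷ μ τ π) (NC n)                                ≈⟨ Σ-cong (NC n) (λ {π} _ → ^-congʳ q (μ≡occurrences _ _ π)) ⟩
    Σ (λ π → q ^ᴷ occurrences τ π) (NC n)
      ≈⟨ Σ-unique (λ π → q ^ᴷ occurrences τ π) (NC-unique n) (Unique.map⁺ encode-injective (trees-unique n n)) (NC⇒encode n) (encode⇒NC n) ⟩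
    Σ (λ π → q ^ᴷ occurrences τ π) (map encode (trees n n))    ≡⟨ Σ-map (λ π → q ^ᴷ occurrences τ π) encode (trees n n) ⟩
    T.F n                                                      ∎
    where open import Relation.Binary.Reasoning.Setoid setoid

  denominator-nonZero : ¬ (2 ·ᴷ (1# + 0#) ≈ 0#) → ¬ (2 ·ᴷ (1# + (q - 1#)) ≈ 0#) → ∀ n → ¬ (denominatorᴷ n 1 ≈ 0#)
  denominator-nonZero two≉0 2q≉0 zero    eq = 2q≉0 (≈-trans (≈-sym denominator-1-zero) eq)
  denominator-nonZero two≉0 2q≉0 (suc n) eq = two≉0 (≈-trans (≈-sym (denominator-1-suc n)) eq)

  -- This and the following equations let the concrete series of the formula enter as variables, so
  -- that the argument stays over the abstract ring `K`.
  GenFunEq : Word → Seriesᴷ → Set c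
  GenFunEq τ gf = ∀ n → gf n ≡ foldr _+_ 0# (map (λ π → q ^ᴷ μ τ π) (NC n))

  ConstEq : Seriesᴷ → Set c
  ConstEq [q-1] = [q-1] ≡ constᴷ (q - 1#)

  RadicandEq DenominatorEq : (a b : ℕ) → Seriesᴷ → Seriesᴷ → Set c
  RadicandEq a b [q-1] rad = rad ≡ S.1# S.- 4 · X S.- 4 · [q-1] S.* X ^ (a ℕ.+ b)
  DenominatorEq a b [q-1] den = den ≡ 2 · X S.* (S.1# S.+ [q-1] S.* X ^ (a ℕ.+ b ∸ 2))

  NumeratorEq : (a b : ℕ) → Seriesᴷ → (Seriesᴷ → Seriesᴷ) → Set c
  NumeratorEq a b [q-1] num = ∀ s → num s ≡ S.1# S.+ 2 · [q-1] S.* X ^ (a ℕ.+ b ∸ 1) S.- s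

  solution : ¬ (2 ·ᴷ (1# + 0#) ≈ 0#) → ¬ (2 ·ᴷ (1# + (q - 1#)) ≈ 0#) →
    ∀ {a b} → a ≡ size (node σl σr) → b ≡ suc b′ →
    (gf [q-1] rad den : Seriesᴷ) (num : Seriesᴷ → Seriesᴷ) →
    GenFunEq (map suc (encode (node σl σr)) ++ replicate b 1) gf → ConstEq [q-1] →
    RadicandEq a b [q-1] rad → DenominatorEq a b [q-1] den → NumeratorEq a b [q-1] num →
    ∃[ root ] IsSqrtᴷ root rad × IsQuotientᴷ gf (num root) den
  solution two≉0 2q≉0 refl refl gf _ _ _ num gf≡ refl refl refl num≡ = root , record
    { square       = solve-quadratic seriesRing X u T.F T.G (size σl ℕ.+ size σr) b′ T.F≈1+G T.G-equation
    ; constantTerm = numerator-0 T.F (a ℕ.+ suc b′ ∸ 1) (a ℕ.+ suc b′ ∸ 2) (ℕ.≤-trans (s≤s z≤n) (ℕ.m≤n+m (suc b′) (size σl ℕ.+ size σr)))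
    } , record
    { nonZero = 1 , denominator-nonZero two≉0 2q≉0 (a ℕ.+ suc b′ ∸ 2)
    ; product = S.trans (S.*-congˡ {D} {gf} {T.F} (λ n → ≈-trans (reflexive (gf≡ n)) (Σ-NC≈F n)))
        (S.trans (y≈x-[x-y] seriesRing C (D S.* T.F)) (S.reflexive (≡.sym (num≡ root))))
    }
    where
    C D root : Seriesᴷ
    C = S.1# S.+ 2 · u S.* X ^ (a ℕ.+ suc b′ ∸ 1)
    D = 2 · X S.* (S.1# S.+ u S.* X ^ (a ℕ.+ suc b′ ∸ 2))
    -- The only series for which the required product `D * F = C - root` can hold.
    root = C S.- D S.* T.F

module _ where

  private
    module K = CommutativeRing ℚ⟨q⟩
    module S = CommutativeRing ℚ⟨q⟩[[x]]

  open import Algebra.Properties.Semiring.Exp K.semiring renaming (_^_ to _^ᴷ_) using ()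
  open import Algebra.Properties.Semiring.Mult K.semiring renaming (_×_ to _·ᴷ_) using ()
  open import Algebra.Properties.Semiring.Exp S.semiring using (_^_)
  open import Algebra.Properties.Semiring.Mult S.semiring renaming (_×_ to _·_) using ()
  open Formula

  two≉0 : ¬ (2 ·ᴷ (K.1# K.+ K.0#) K.≈ K.0#)
  two≉0 (Fractions.crossMul (Polynomials.coeffwise eq)) with () ← eq 0

  2q≉0 : ¬ (2 ·ᴷ (K.1# K.+ (q K.- K.1#)) K.≈ K.0#)
  -- The constant coefficient of `2q` is 0, so the contradiction comes from the coefficient of `q`.
  2q≉0 (Fractions.crossMul (Polynomials.coeffwise eq)) with () ← eq 1

  -- All of these hold by refl.  They are named so that both sides of each
  -- comparison are unfolded definitions, which match syntactically; otherwise
  -- conversion expands the arithmetic of fractions of polynomials.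
  GenFun-def [q-1]-def Radicand-def Denominator-def Numerator-def : Set
  GenFun-def      = ∀ τ n → genFun τ n ≡ foldr K._+_ K.0# (map (λ π → q ^ᴷ μ τ π) (NC n))
  [q-1]-def       = ∀ a b → [q-1] a b ≡ const (q K.- K.1#)
  Radicand-def    = ∀ a b → radicand a b ≡ S.1# S.- 4 · x S.- 4 · [q-1] a b S.* x ^ (a ℕ.+ b)
  Denominator-def = ∀ a b → denominator a b ≡ 2 · x S.* (S.1# S.+ [q-1] a b S.* x ^ (a ℕ.+ b ∸ 2))
  Numerator-def   = ∀ a b s → numerator a b s ≡ S.1# S.+ 2 · [q-1] a b S.* x ^ (a ℕ.+ b ∸ 1) S.- s

  genFun-def : GenFun-def
  genFun-def _ _ = refl

  q-1-def : [q-1]-def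
  q-1-def _ _ = refl

  radicand-def : Radicand-def
  radicand-def _ _ = refl

  denominator-def : Denominator-def
  denominator-def _ _ = refl

  numerator-def : Numerator-def
  numerator-def _ _ _ = refl

  Conclusion : ℕ → ℕ → Word → Set
  Conclusion a b ρ = ∃[ S ] IsSqrt S (radicand a b) ×
    IsQuotient (genFun (map suc ρ ++ replicate b 1)) (numerator a b S) (denominator a b)

  conclusion-encode : ∀ a b′ t → 1 ≤ size t → size t ≡ a → (1 ≤ b′ → run t ≡ 1) → Conclusion a (suc b′) (encode t)
  conclusion-encode a b′ (node σl σr) _ size≡a run-σ =
    Solution.solution ℚ⟨q⟩ q σl σr b′ run-σ two≉0 2q≉0 (≡.sym size≡a) refl
      (genFun (map suc (encode (node σl σr)) ++ replicate (suc b′) 1))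
      ([q-1] a (suc b′)) (radicand a (suc b′)) (denominator a (suc b′)) (numerator a (suc b′))
      (genFun-def (map suc (encode (node σl σr)) ++ replicate (suc b′) 1))
      (q-1-def a (suc b′)) (radicand-def a (suc b′)) (denominator-def a (suc b′)) (numerator-def a (suc b′))

  conclusion : ∀ a b → 1 ≤ a → 1 ≤ b → ∀ ρ → IsCanonical ρ → NonCrossing ρ → length ρ ≡ a →
    (2 ≤ b → initialRun ρ ≡ 1) → Conclusion a b ρ
  conclusion a (suc b′) 1≤a _ ρ canonical nonCrossing length≡a run-ρ =
    fromTree (canonicalNonCrossing⇒encode canonical nonCrossing)
    where
    fromTree : ∃[ t ] ρ ≡ encode t → Conclusion a (suc b′) ρ
    fromTree (t , refl) = conclusion-encode a b′ t (≡.subst (1 ≤_) (≡.sym size≡a) 1≤a) size≡a (λ 1≤b′ → run-ρ (s≤s 1≤b′))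
      where size≡a = ≡.trans (≡.sym (length-encode t)) length≡a

theorem4 : ∀ (a b : ℕ) → 1 ≤ a → 1 ≤ b →
    ∀ (ρ : Word) → IsCanonical ρ → NonCrossing ρ → length ρ ≡ a →
    (2 ≤ b → initialRun ρ ≡ 1) →
    let open Formula a b
        τ = map suc ρ ++ replicate b 1
    in ∃[ S ] IsSqrt S radicand × IsQuotient (genFun τ) (numerator S) denominator
theorem4 = conclusion
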